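{- Let $R$ be a finite Frobenius ring and $w$ a homogeneous weight on $R$ with average value $\gamma$, extended additively to $R^n$. Let $C\leq {}_RR^n$ be a nonzero linear code of length $n$ and minimum homogeneous weight $d$ satisfying $\gamma n<d$, and let $c\in C$ be such that $\gamma\,\ell(c)<d$. Then $$|C|\;\leq\;|Rc|\,\frac{d-\gamma\,\ell(c)}{d-\gamma n}.$$
   Context: A finite ring $R$ (with identity) is Frobenius if the character group of $(R,+)$ is isomorphic to $R$ as a left $R$-module (equivalently, $R$ has a character whose kernel contains no nonzero left or right ideal). A function $w:R\to\mathbb{R}$ is a homogeneous weight with average value $\gamma$ if $w(0)=0$, $w(x)=w(y)$ whenever $Rx=Ry$, and $\sum_{y\in Rx} w(y)=\gamma|Rx|$ for all nonzero $x\in R$; on $R^n$, $w(c)=\sum_i w(c_i)$. Minimum homogeneous weight of a code is the minimum of $w$ over its nonzero words. For $c\in R^n$, $\ell(c)$ denotes the Hamming weight, i.e. the number of nonzero coordinates of $c$.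
   Formalization: The homogeneous weight w, its average value γ and the minimum homogeneous weight d are taken to be rational instead of real. -}

module Defs where

open import Level using (0ℓ)
open import Algebra.Bundles using (Ring)
open import Data.Nat as ℕ using (ℕ; zero; suc; NonZero)
open import Data.Nat.DivMod using (_%_)
open import Data.Integer as ℤ using (ℤ)
open import Data.Fin as Fin using (Fin)
open import Data.Fin.Properties using (any?; all?)
open import Data.Vec as Vec using (Vec; []; _∷_; lookup)
open import Data.Vec.Properties using (lookup-map)
open import Data.List as List using (List; length; filter; allFin; concatMap; foldr)
open import Data.Product using (Σ; ∃; _×_; _,_)
open import Data.Rational as ℚ using (ℚ; 0ℚ)
open import Data.Rational.Properties using (pos⇒nonZero; +-monoˡ-<; +-inverseʳ)
open import Relation.Nullary using (¬_; Dec; yes; no)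
open import Relation.Nullary.Decidable using (map′; ¬?)
open import Relation.Unary using (Pred; Decidable)
import Relation.Binary.PropositionalEquality as ≡
open ≡ using (_≡_)

record FiniteRing : Set₁ where
  field
    ring : Ring 0ℓ 0ℓ
  open Ring ring public
  field
    size         : ℕ
    toElem       : Fin size → Carrier
    index        : Carrier → Fin size
    index-cong   : ∀ {x y} → x ≈ y → index x ≡ index y
    toElem-index : ∀ x → toElem (index x) ≈ x
    index-toElem : ∀ i → index (toElem i) ≡ i

toℚ : ℕ → ℚ
toℚ n = ℤ.+ n ℚ./ 1

private
  fin⇒nonZero : ∀ {n} → Fin n → NonZero n
  fin⇒nonZero {suc n} _ = _

module _ (R : FiniteRing) where
  open FiniteRing R

  instance
    size-nonZero : NonZero size
    size-nonZero = fin⇒nonZero (index 0#)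

  _≈?_ : (x y : Carrier) → Dec (x ≈ y)
  x ≈? y = map′
    (λ e → trans (sym (toElem-index x)) (trans (reflexive (≡.cong toElem e)) (toElem-index y)))
    index-cong
    (index x Fin.≟ index y)

  countR : {P : Pred Carrier 0ℓ} → Decidable P → ℕ
  countR P? = length (filter (λ i → P? (toElem i)) (allFin size))

  sumR : {P : Pred Carrier 0ℓ} → Decidable P → (Carrier → ℚ) → ℚ
  sumR P? f = foldr (λ i s → f (toElem i) ℚ.+ s) 0ℚ (filter (λ i → P? (toElem i)) (allFin size))

  InRx : Carrier → Pred Carrier 0ℓ
  InRx x y = ∃ λ r → r * x ≈ y

  inRx? : (x : Carrier) → Decidable (InRx x)
  inRx? x y = map′
    (λ { (i , e) → toElem i , e })
    (λ { (r , e) → index r , trans (*-cong (toElem-index r) refl) e })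
    (any? (λ i → (toElem i * x) ≈? y))

  cardRx : Carrier → ℕ
  cardRx x = countR (inRx? x)

  SameLeftIdeal : Carrier → Carrier → Set
  SameLeftIdeal x y = (∀ z → InRx x z → InRx y z) × (∀ z → InRx y z → InRx x z)

  record IsLeftIdeal (I : Pred Carrier 0ℓ) : Set where
    field
      resp       : ∀ {x y} → x ≈ y → I x → I y
      zero∈      : I 0#
      +-closed   : ∀ {x y} → I x → I y → I (x + y)
      neg-closed : ∀ {x} → I x → I (- x)
      *-closedˡ  : ∀ r {x} → I x → I (r * x)

  record IsRightIdeal (I : Pred Carrier 0ℓ) : Set where
    field
      resp       : ∀ {x y} → x ≈ y → I x → I y
      zero∈      : I 0#
      +-closed   : ∀ {x y} → I x → I y → I (x + y)
      neg-closed : ∀ {x} → I x → I (- x)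
      *-closedʳ  : ∀ r {x} → I x → I (x * r)

  -- A character of (R,+): a group homomorphism (R,+) → ℤ/|R|ℤ
  -- (every complex character of a group of order |R| takes values in
  -- the |R|-th roots of unity ≅ ℤ/|R|ℤ), represented by ℕ-values mod |R|.
  IsCharacter : (Carrier → ℕ) → Set
  IsCharacter χ =
    (∀ {x y} → x ≈ y → χ x % size ≡ χ y % size) ×
    (∀ x y → χ (x + y) % size ≡ (χ x ℕ.+ χ y) % size)

  InKernel : (Carrier → ℕ) → Carrier → Set
  InKernel χ x = χ x % size ≡ 0

  IsFrobenius : Set₁
  IsFrobenius = Σ (Carrier → ℕ) λ χ → IsCharacter χ ×
    (∀ (I : Pred Carrier 0ℓ) → IsLeftIdeal I → (∀ x → I x → InKernel χ x) → ∀ x → I x → x ≈ 0#) ×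
    (∀ (I : Pred Carrier 0ℓ) → IsRightIdeal I → (∀ x → I x → InKernel χ x) → ∀ x → I x → x ≈ 0#)

  record IsHomogeneousWeight (w : Carrier → ℚ) (γ : ℚ) : Set where
    field
      w-zero    : w 0# ≡ 0ℚ
      w-ideal   : ∀ x y → SameLeftIdeal x y → w x ≡ w y
      w-average : ∀ x → ¬ (x ≈ 0#) → sumR (inRx? x) w ≡ γ ℚ.* toℚ (cardRx x)

  Word : ℕ → Set
  Word n = Vec Carrier n

  _≈ᵛ_ : ∀ {n} → Word n → Word n → Set
  u ≈ᵛ v = ∀ i → lookup u i ≈ lookup v i

  _≈ᵛ?_ : ∀ {n} (u v : Word n) → Dec (u ≈ᵛ v)
  u ≈ᵛ? v = all? (λ i → lookup u i ≈? lookup v i)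

  0ᵛ : ∀ {n} → Word n
  0ᵛ {n} = Vec.replicate n 0#

  _+ᵛ_ : ∀ {n} → Word n → Word n → Word n
  _+ᵛ_ = Vec.zipWith _+_

  _·ᵛ_ : ∀ {n} → Carrier → Word n → Word n
  r ·ᵛ c = Vec.map (r *_) c

  wtᵛ : (Carrier → ℚ) → ∀ {n} → Word n → ℚ
  wtᵛ w c = Vec.foldr _ (λ x s → w x ℚ.+ s) 0ℚ c

  hamming : ∀ {n} → Word n → ℕ
  hamming {n} c = length (filter (λ i → ¬? (lookup c i ≈? 0#)) (allFin n))

  -- list of all words of length n (each exactly once, up to ≈)
  allWords : (n : ℕ) → List (Word n)
  allWords zero = List.[ [] ]
  allWords (suc n) = concatMap (λ i → List.map (toElem i ∷_) (allWords n)) (allFin size)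

  countW : ∀ {n} {P : Pred (Word n) 0ℓ} → Decidable P → ℕ
  countW {n} P? = length (filter P? (allWords n))

  InRc : ∀ {n} → Word n → Pred (Word n) 0ℓ
  InRc c v = ∃ λ r → (r ·ᵛ c) ≈ᵛ v

  inRc? : ∀ {n} (c : Word n) → Decidable (InRc c)
  inRc? c v = map′
    (λ { (i , e) → toElem i , e })
    (λ { (r , e) → index r , λ j → trans (≈-scale r j) (e j) })
    (any? (λ i → (toElem i ·ᵛ c) ≈ᵛ? v))
    where
      ≈-scale : ∀ r j → lookup (toElem (index r) ·ᵛ c) j ≈ lookup (r ·ᵛ c) j
      ≈-scale r j = trans (reflexive (lookup-map j (toElem (index r) *_) c))
                      (trans (*-cong (toElem-index r) refl)
                        (reflexive (≡.sym (lookup-map j (r *_) c))))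

  cardRc : ∀ {n} → Word n → ℕ
  cardRc c = countW (inRc? c)

  record IsLinearCode (n : ℕ) (C : Pred (Word n) 0ℓ) : Set where
    field
      resp     : ∀ {u v} → u ≈ᵛ v → C u → C v
      zero∈    : C 0ᵛ
      +-closed : ∀ {u v} → C u → C v → C (u +ᵛ v)
      ·-closed : ∀ r {u} → C u → C (r ·ᵛ u)

  IsNonzeroCode : (n : ℕ) → Pred (Word n) 0ℓ → Set
  IsNonzeroCode n C = ∃ λ c → C c × ¬ (c ≈ᵛ 0ᵛ)

  IsMinWeight : (w : Carrier → ℚ) (n : ℕ) → Pred (Word n) 0ℓ → ℚ → Set
  IsMinWeight w n C d =
    (∃ λ c → C c × ¬ (c ≈ᵛ 0ᵛ) × wtᵛ w c ≡ d) ×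
    (∀ c → C c → ¬ (c ≈ᵛ 0ᵛ) → d ℚ.≤ wtᵛ w c)

<⇒0<- : ∀ {p q : ℚ} → p ℚ.< q → 0ℚ ℚ.< q ℚ.- p
<⇒0<- {p} {q} p<q = ≡.subst (ℚ._< q ℚ.- p) (+-inverseʳ p) (+-monoˡ-< (ℚ.- p) p<q)

boundQuot : (k : ℕ) (a p q : ℚ) → p ℚ.< q → ℚ
boundQuot k a p q p<q = (toℚ k ℚ.* a ℚ.÷ (q ℚ.- p)) {{pos⇒nonZero (q ℚ.- p) {{ℚ.positive (<⇒0<- p<q)}}}}

{-# OPTIONS --safe #-}

-- Let f = γ - w and let ψ : R → ℚ satisfy ψ(0) = 1 and sum to zero over every nonzero left ideal. Then f - γψ sums to zero
-- over every principal left ideal, hence over every left ideal, and so w has average γ on every nonzero left ideal.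
-- Such a ψ arises from the Frobenius character, whose image on a nonzero left ideal is a nontrivial subgroup of ℤ/N.
--
-- Consequently the words of a linear code D with m(D) not identically zero coordinates have total weight γ m(D) |D|.
-- The words of C outside Rc have weight at least d, and m(Rc) = ℓ(c), so
-- γ m(C) |C| ≥ γ ℓ(c) |Rc| + d (|C| - |Rc|), that is, |C| (d - γ m(C)) ≤ |Rc| (d - γ ℓ(c)).
-- As m(C) ≤ n, the bound follows once γ ≥ 0 is known.

module Submission where

open import Defs
open import Level using (0ℓ)
open import Data.Nat as ℕ using (ℕ; zero; suc)
open import Data.Rational as ℚ using (ℚ; 0ℚ; 1ℚ; _+_; _*_)
open import Relation.Unary using (Pred; Decidable)

import Data.Integer as ℤ
import Data.Integer.Properties as ℤₚ
import Data.Nat.Properties as ℕₚ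
import Data.Rational.Properties as ℚₚ
open import Data.Rational.Solver using (module +-*-Solver)
import Data.Rational.Unnormalised as ℚᵘ
import Data.Rational.Unnormalised.Properties as ℚᵘₚ
open import Data.Bool using (true; false; if_then_else_)
open import Data.Fin as Fin using (Fin)
open import Data.List using (List; []; _∷_; map; concatMap; filter; length; foldr; allFin; _++_)
import Data.Fin.Properties as Finₚ
open import Data.List.Properties using (map-tabulate)
open import Data.List.Relation.Unary.Any as Any using (Any; here; there)
open import Data.Product using (∃; _×_; _,_; proj₁; proj₂)
open import Data.Fin.Induction using (spo-wellFounded)
open import Data.Nat using (NonZero)
open import Data.Nat.Divisibility using (_∣_; _∣?_; divides; ∣-refl; ∣⇒≤; m%n≡0⇒n∣m; n∣m⇒m%n≡0)
open import Data.Nat.DivMod using (_%_; %-distribˡ-+; [m+kn]%n≡m%n; m≡m%n+[m/n]*n; m%n<n; m*n%n≡0; n%n≡0)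
open import Induction.WellFounded using (WellFounded; Acc; acc)
import Algebra.Properties.Ring as RingProperties
open import Data.Unit using (tt)
open import Data.Vec using ([]; _∷_; lookup)
open import Data.Vec.Properties using (lookup-zipWith; lookup-map; lookup-replicate)
open import Function using (_∘_; id)
open import Relation.Binary.PropositionalEquality hiding (resp)
open import Relation.Nullary using (¬_; Dec; yes; no; does; contradiction)
open import Relation.Nullary.Decidable using (map′; ¬?; _×-dec_)

open +-*-Solver using (solve; con; _:+_; _:*_; _:-_; _:=_; :-_)
open ≡-Reasoning

-- Rational indicators of decidable propositions.

⟦_⟧ : {P : Set} → Dec P → ℚ
⟦ d ⟧ = if does d then 1ℚ else 0ℚ

⟦⟧-true : {P : Set} (d : Dec P) → P → ⟦ d ⟧ ≡ 1ℚ
⟦⟧-true (yes _) _ = refl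
⟦⟧-true (no ¬p) p = contradiction p ¬p

⟦⟧-false : {P : Set} (d : Dec P) → ¬ P → ⟦ d ⟧ ≡ 0ℚ
⟦⟧-false (yes p) ¬p = contradiction p ¬p
⟦⟧-false (no _)  _  = refl

⟦⟧-cong : {P Q : Set} (d : Dec P) (e : Dec Q) → (P → Q) → (Q → P) → ⟦ d ⟧ ≡ ⟦ e ⟧
⟦⟧-cong (yes p) e f g = sym (⟦⟧-true e (f p))
⟦⟧-cong (no ¬p) e f g = sym (⟦⟧-false e (¬p ∘ g))

⟦⟧-× : {P Q : Set} (d : Dec P) (e : Dec Q) → ⟦ d ×-dec e ⟧ ≡ ⟦ d ⟧ * ⟦ e ⟧
⟦⟧-× (yes _) e = sym (ℚₚ.*-identityˡ ⟦ e ⟧)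
⟦⟧-× (no _)  e = sym (ℚₚ.*-zeroˡ ⟦ e ⟧)

⟦⟧*-cong : {P : Set} (d : Dec P) {x y : ℚ} → (P → x ≡ y) → ⟦ d ⟧ * x ≡ ⟦ d ⟧ * y
⟦⟧*-cong (yes p)         x≡y = cong (1ℚ *_) (x≡y p)
⟦⟧*-cong (no _) {x} {y}  _   = trans (ℚₚ.*-zeroˡ x) (sym (ℚₚ.*-zeroˡ y))

0≤⟦⟧ : {P : Set} (d : Dec P) → 0ℚ ℚ.≤ ⟦ d ⟧
0≤⟦⟧ (yes _) = ℚₚ.nonNegative⁻¹ 1ℚ
0≤⟦⟧ (no _)  = ℚₚ.≤-refl

⟦⟧-mono : {P Q : Set} (d : Dec P) (e : Dec Q) → (P → Q) → ⟦ d ⟧ ℚ.≤ ⟦ e ⟧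
⟦⟧-mono (yes p) e P⇒Q = ℚₚ.≤-reflexive (sym (⟦⟧-true e (P⇒Q p)))
⟦⟧-mono (no _)  e _   = 0≤⟦⟧ e

-- The equation is plain integer arithmetic on unnormalised rationals, whereas `toℚ` normalises by a
-- gcd that is stuck on a variable.
toℚ-suc : ∀ n → toℚ (suc n) ≡ 1ℚ + toℚ n
toℚ-suc n = ℚₚ.toℚᵘ-injective (
  ℚᵘₚ.≃-trans (ℚₚ.toℚᵘ-fromℚᵘ (ℚᵘ.mkℚᵘ (ℤ.+ suc n) 0))
  (ℚᵘₚ.≃-trans (ℚᵘ.*≡* (cong (λ z → (ℤ.+ 1 ℤ.+ z) ℤ.* ℤ.+ 1) (sym (ℤₚ.*-identityʳ (ℤ.+ n)))))
  (ℚᵘₚ.≃-trans (ℚᵘₚ.+-congʳ ℚᵘ.1ℚᵘ (ℚᵘₚ.≃-sym (ℚₚ.toℚᵘ-fromℚᵘ (ℚᵘ.mkℚᵘ (ℤ.+ n) 0))))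
  (ℚᵘₚ.≃-sym (ℚₚ.toℚᵘ-homo-+ 1ℚ (toℚ n))))))

-- Finite sums of rationals.

opaque
  -- Opaque, so that sums stay folded during unification and the summands left as `_` can be read
  -- off the goal; `∑-[]`, `∑-∷` and `foldr≡∑` give access to the fold from outside.
  ∑ : {A : Set} → List A → (A → ℚ) → ℚ
  ∑ xs f = foldr (λ x s → f x + s) 0ℚ xs

  ∑-cong : {A : Set} (xs : List A) {f g : A → ℚ} → (∀ x → f x ≡ g x) → ∑ xs f ≡ ∑ xs g
  ∑-cong []       f≗g = refl
  ∑-cong (x ∷ xs) f≗g = cong₂ _+_ (f≗g x) (∑-cong xs f≗g)

  ∑-zero : {A : Set} (xs : List A) {f : A → ℚ} → (∀ x → f x ≡ 0ℚ) → ∑ xs f ≡ 0ℚ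
  ∑-zero []       f≗0 = refl
  ∑-zero (x ∷ xs) f≗0 = cong₂ _+_ (f≗0 x) (∑-zero xs f≗0)

  ∑-mono : {A : Set} (xs : List A) {f g : A → ℚ} → (∀ x → f x ℚ.≤ g x) → ∑ xs f ℚ.≤ ∑ xs g
  ∑-mono []       f≤g = ℚₚ.≤-refl
  ∑-mono (x ∷ xs) f≤g = ℚₚ.+-mono-≤ (f≤g x) (∑-mono xs f≤g)

  ∑-+ : {A : Set} (xs : List A) (f g : A → ℚ) → ∑ xs (λ x → f x + g x) ≡ ∑ xs f + ∑ xs g
  ∑-+ []       f g = refl
  ∑-+ (x ∷ xs) f g = trans (cong (f x + g x +_) (∑-+ xs f g))
    (solve 4 (λ a b s t → a :+ b :+ (s :+ t) := a :+ s :+ (b :+ t)) refl (f x) (g x) (∑ xs f) (∑ xs g))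

  ∑-*ˡ : {A : Set} (c : ℚ) (xs : List A) (f : A → ℚ) → ∑ xs (λ x → c * f x) ≡ c * ∑ xs f
  ∑-*ˡ c []       f = sym (ℚₚ.*-zeroʳ c)
  ∑-*ˡ c (x ∷ xs) f = trans (cong (c * f x +_) (∑-*ˡ c xs f)) (sym (ℚₚ.*-distribˡ-+ c (f x) (∑ xs f)))

  ∑-*ʳ : {A : Set} (c : ℚ) (xs : List A) (f : A → ℚ) → ∑ xs (λ x → f x * c) ≡ ∑ xs f * c
  ∑-*ʳ c xs f = begin
    ∑ xs (λ x → f x * c)  ≡⟨ ∑-cong xs (λ x → ℚₚ.*-comm (f x) c) ⟩
    ∑ xs (λ x → c * f x)  ≡⟨ ∑-*ˡ c xs f ⟩
    c * ∑ xs f            ≡⟨ ℚₚ.*-comm c (∑ xs f) ⟩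
    ∑ xs f * c            ∎

  ∑-comm : {A B : Set} (xs : List A) (ys : List B) (f : A → B → ℚ) →
    ∑ xs (λ x → ∑ ys (f x)) ≡ ∑ ys (λ y → ∑ xs (λ x → f x y))
  ∑-comm []       ys f = sym (∑-zero ys (λ _ → refl))
  ∑-comm (x ∷ xs) ys f = trans (cong (∑ ys (f x) +_) (∑-comm xs ys f))
    (sym (∑-+ ys (f x) (λ y → ∑ xs (λ x′ → f x′ y))))

  ∑-map : {A B : Set} (h : A → B) (xs : List A) (f : B → ℚ) → ∑ (map h xs) f ≡ ∑ xs (f ∘ h)
  ∑-map h []       f = refl
  ∑-map h (x ∷ xs) f = cong (f (h x) +_) (∑-map h xs f)

  ∑-++ : {A : Set} (xs ys : List A) (f : A → ℚ) → ∑ (xs ++ ys) f ≡ ∑ xs f + ∑ ys f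
  ∑-++ []       ys f = sym (ℚₚ.+-identityˡ _)
  ∑-++ (x ∷ xs) ys f = trans (cong (f x +_) (∑-++ xs ys f)) (sym (ℚₚ.+-assoc (f x) (∑ xs f) (∑ ys f)))

  ∑-concatMap : {A B : Set} (h : A → List B) (xs : List A) (f : B → ℚ) →
    ∑ (concatMap h xs) f ≡ ∑ xs (λ x → ∑ (h x) f)
  ∑-concatMap h []       f = refl
  ∑-concatMap h (x ∷ xs) f = trans (∑-++ (h x) (concatMap h xs) f) (cong (∑ (h x) f +_) (∑-concatMap h xs f))

  ∑-filter : {A : Set} {P : Pred A 0ℓ} (P? : Decidable P) (xs : List A) (f : A → ℚ) →
    ∑ (filter P? xs) f ≡ ∑ xs (λ x → ⟦ P? x ⟧ * f x)
  ∑-filter P? []       f = refl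
  ∑-filter P? (x ∷ xs) f with does (P? x)
  ... | true  = cong₂ _+_ (sym (ℚₚ.*-identityˡ (f x))) (∑-filter P? xs f)
  ... | false = trans (∑-filter P? xs f)
    (trans (sym (ℚₚ.+-identityˡ _)) (cong (_+ ∑ xs (λ y → ⟦ P? y ⟧ * f y)) (sym (ℚₚ.*-zeroˡ (f x)))))

  toℚ-length-filter : {A : Set} {P : Pred A 0ℓ} (P? : Decidable P) (xs : List A) →
    toℚ (length (filter P? xs)) ≡ ∑ xs (λ x → ⟦ P? x ⟧)
  toℚ-length-filter P? []       = refl
  toℚ-length-filter P? (x ∷ xs) with does (P? x)
  ... | true  = trans (toℚ-suc (length (filter P? xs))) (cong (1ℚ +_) (toℚ-length-filter P? xs))
  ... | false = trans (toℚ-length-filter P? xs) (sym (ℚₚ.+-identityˡ _))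

  ∑-[] : {A : Set} {f : A → ℚ} → ∑ [] f ≡ 0ℚ
  ∑-[] = refl

  ∑-∷ : {A : Set} (x : A) (xs : List A) (f : A → ℚ) → ∑ (x ∷ xs) f ≡ f x + ∑ xs f
  ∑-∷ x xs f = refl

  foldr≡∑ : {A : Set} (xs : List A) (f : A → ℚ) → foldr (λ x s → f x + s) 0ℚ xs ≡ ∑ xs f
  foldr≡∑ xs f = refl

-- Finite enumerations up to a relation.

record Enumeration {A : Set} (_≈_ : A → A → Set) : Set where
  infix 4 _≟_
  field
    _≟_ : ∀ x y → Dec (x ≈ y)
    elems : List A
    -- Completeness and absence of repetitions in one equation, phrased as a sum so that it applies
    -- directly after two sums are exchanged.
    once : ∀ y → ∑ elems (λ x → ⟦ x ≟ y ⟧) ≡ 1ℚ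

  sift : ∀ y {f : A → ℚ} → (∀ {x} → x ≈ y → f x ≡ f y) → ∑ elems (λ x → ⟦ x ≟ y ⟧ * f x) ≡ f y
  sift y {f} f-resp = begin
    ∑ elems (λ x → ⟦ x ≟ y ⟧ * f x)  ≡⟨ ∑-cong elems (λ x → ⟦⟧*-cong (x ≟ y) f-resp) ⟩
    ∑ elems (λ x → ⟦ x ≟ y ⟧ * f y)  ≡⟨ ∑-*ʳ (f y) elems (λ x → ⟦ x ≟ y ⟧) ⟩
    ∑ elems (λ x → ⟦ x ≟ y ⟧) * f y  ≡⟨ cong (_* f y) (once y) ⟩
    1ℚ * f y                          ≡⟨ ℚₚ.*-identityˡ (f y) ⟩
    f y                               ∎

  -- Expand each `f (σ y)` by `sift` and exchange the sums: the coefficient of `f x` counts the `y`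
  -- with `x ≈ σ y`, equivalently `y ≈ τ x`, and `once` makes it 1.
  reindex : (σ τ : A → A) → (∀ {x y} → x ≈ σ y → y ≈ τ x) → (∀ {x y} → y ≈ τ x → x ≈ σ y) →
    {f : A → ℚ} → (∀ {x y} → x ≈ y → f x ≡ f y) → ∑ elems (f ∘ σ) ≡ ∑ elems f
  reindex σ τ to from {f} f-resp = begin
    ∑ elems (f ∘ σ)
      ≡⟨ ∑-cong elems (λ y → sift (σ y) f-resp) ⟨
    ∑ elems (λ y → ∑ elems (λ x → ⟦ x ≟ σ y ⟧ * f x))
      ≡⟨ ∑-comm elems elems _ ⟩
    ∑ elems (λ x → ∑ elems (λ y → ⟦ x ≟ σ y ⟧ * f x))
      ≡⟨ ∑-cong elems (λ x → ∑-*ʳ (f x) elems _) ⟩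
    ∑ elems (λ x → ∑ elems (λ y → ⟦ x ≟ σ y ⟧) * f x)
      ≡⟨ ∑-cong elems (λ x → cong (_* f x) (∑-cong elems (λ y → ⟦⟧-cong (x ≟ σ y) (y ≟ τ x) to from))) ⟩
    ∑ elems (λ x → ∑ elems (λ y → ⟦ y ≟ τ x ⟧) * f x)
      ≡⟨ ∑-cong elems (λ x → trans (cong (_* f x) (once (τ x))) (ℚₚ.*-identityˡ (f x))) ⟩
    ∑ elems f
      ∎

  -- Were nothing in the list related to `y`, every indicator in `once y` would vanish and the sum
  -- would be 0 instead of 1.
  listed : ∀ y → Any (_≈ y) elems
  listed y = go elems (λ e → contradiction (trans (sym (once y)) e) λ ())
    where
    go : ∀ xs → ∑ xs (λ x → ⟦ x ≟ y ⟧) ≢ 0ℚ → Any (_≈ y) xs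
    go []       ≢0 = contradiction ∑-[] ≢0
    go (x ∷ xs) ≢0 with x ≟ y
    ... | yes x≈y = here x≈y
    ... | no  x≉y = there (go xs (λ e → ≢0 (trans (∑-∷ x xs _) (cong₂ _+_ (⟦⟧-false (x ≟ y) x≉y) e))))

  search : {P : Pred A 0ℓ} → Decidable P → (∀ {x y} → x ≈ y → P y → P x) → Dec (∃ P)
  search P? P-resp = map′ Any.satisfied (λ (y , Py) → Any.map (λ x≈y → P-resp x≈y Py) (listed y)) (Any.any? P? elems)

  -- Applied with a translation as `σ`, this shows that the nonempty fibres of an additive map all
  -- have the same size.
  count-shift : (σ τ : A → A) → (∀ {x y} → x ≈ σ y → y ≈ τ x) → (∀ {x y} → y ≈ τ x → x ≈ σ y) →
    {P Q : Pred A 0ℓ} (P? : Decidable P) (Q? : Decidable Q) → (∀ {x y} → x ≈ y → Q x → Q y) →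
    (∀ {x y} → x ≈ y → Q y → Q x) → (∀ y → P y → Q (σ y)) → (∀ y → Q (σ y) → P y) →
    ∑ elems (λ y → ⟦ Q? y ⟧) ≡ ∑ elems (λ y → ⟦ P? y ⟧)
  count-shift σ τ to from P? Q? Q-resp Q-resp′ P⇒Q Q⇒P = trans
    (sym (reindex σ τ to from (λ {x} {y} x≈y → ⟦⟧-cong (Q? x) (Q? y) (Q-resp x≈y) (Q-resp′ x≈y))))
    (∑-cong elems (λ y → ⟦⟧-cong (Q? (σ y)) (P? y) (Q⇒P y) (P⇒Q y)))

  ∑-split : {P Q : Pred A 0ℓ} (P? : Decidable P) (Q? : Decidable Q) → (∀ {x} → Q x → P x) → (f : A → ℚ) →
    ∑ elems (λ x → ⟦ P? x ⟧ * f x) ≡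
    ∑ elems (λ x → ⟦ Q? x ⟧ * f x) + ∑ elems (λ x → ⟦ P? x ×-dec ¬? (Q? x) ⟧ * f x)
  ∑-split P? Q? Q⇒P f = trans (∑-cong elems pointwise) (∑-+ elems _ _)
    where
    pointwise : ∀ x → ⟦ P? x ⟧ * f x ≡ ⟦ Q? x ⟧ * f x + ⟦ P? x ×-dec ¬? (Q? x) ⟧ * f x
    pointwise x with P? x | Q? x
    ... | yes _ | yes _ = solve 1 (λ a → con 1ℚ :* a := con 1ℚ :* a :+ con 0ℚ :* a) refl (f x)
    ... | yes _ | no  _ = solve 1 (λ a → con 1ℚ :* a := con 0ℚ :* a :+ con 1ℚ :* a) refl (f x)
    ... | no ¬p | yes q = contradiction (Q⇒P q) ¬p
    ... | no  _ | no  _ = solve 1 (λ a → con 0ℚ :* a := con 0ℚ :* a :+ con 0ℚ :* a) refl (f x)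

  -- The set `S` is a disjoint union of classes. The recursion treats `elems` as a list of candidate
  -- representatives: a head inside `S` has its class split off, a head outside `S` is dropped. The
  -- invariant `covered` says that every element still in the set is matched by a remaining
  -- candidate.
  ∑-classes : {_∼_ : A → A → Set} (_∼?_ : ∀ x y → Dec (x ∼ y)) →
    (∀ {x y} → x ∼ y → y ∼ x) → (∀ {x y z} → x ∼ y → y ∼ z → x ∼ z) → (∀ {x y} → x ≈ y → x ∼ y) →
    (f : A → ℚ) {S : Pred A 0ℓ} (S? : Decidable S) → (∀ {x y} → x ∼ y → S x → S y) →
    (∀ x → S x → ∑ elems (λ y → ⟦ x ∼? y ⟧ * f y) ≡ 0ℚ) →
    ∑ elems (λ y → ⟦ S? y ⟧ * f y) ≡ 0ℚ
  ∑-classes {_∼_} _∼?_ ∼-sym ∼-trans ≈⇒∼ f S? S-resp null = go elems S? S-resp null (λ {x} _ → listed x)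
    where
    go : ∀ reps {S : Pred A 0ℓ} (S? : Decidable S) → (∀ {x y} → x ∼ y → S x → S y) →
      (∀ x → S x → ∑ elems (λ y → ⟦ x ∼? y ⟧ * f y) ≡ 0ℚ) →
      (∀ {x} → S x → Any (_≈ x) reps) → ∑ elems (λ y → ⟦ S? y ⟧ * f y) ≡ 0ℚ
    go [] S? S-resp null covered = ∑-zero elems λ y →
      trans (cong (_* f y) (⟦⟧-false (S? y) (λ Sy → contradiction (covered Sy) λ ()))) (ℚₚ.*-zeroˡ (f y))
    go (r ∷ reps) S? S-resp null covered with S? r
    ... | no ¬Sr = go reps S? S-resp null λ Sx →
      Any.tail (λ r≈x → ¬Sr (S-resp (∼-sym (≈⇒∼ r≈x)) Sx)) (covered Sx)
    ... | yes Sr = begin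
      ∑ elems (λ y → ⟦ S? y ⟧ * f y)
        ≡⟨ ∑-split S? (r ∼?_) (λ r∼x → S-resp r∼x Sr) f ⟩
      ∑ elems (λ y → ⟦ r ∼? y ⟧ * f y) + ∑ elems (λ y → ⟦ S? y ×-dec ¬? (r ∼? y) ⟧ * f y)
        ≡⟨ cong₂ _+_ (null r Sr) (go reps (λ y → S? y ×-dec ¬? (r ∼? y))
             (λ x∼y (Sx , r≁x) → S-resp x∼y Sx , λ r∼y → r≁x (∼-trans r∼y (∼-sym x∼y)))
             (λ x (Sx , _) → null x Sx)
             (λ (Sx , r≁x) → Any.tail (λ r≈x → r≁x (≈⇒∼ r≈x)) (covered Sx))) ⟩
      0ℚ ∎

-- Sums over `Fin` and triangular linear systems.

∑-allFin-suc : ∀ n (f : Fin (suc n) → ℚ) → ∑ (allFin (suc n)) f ≡ f Fin.zero + ∑ (allFin n) (f ∘ Fin.suc)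
∑-allFin-suc n f = trans (∑-∷ Fin.zero _ f) (cong (f Fin.zero +_) (trans
  (cong (λ xs → ∑ xs f) (sym (map-tabulate {n = n} id Fin.suc))) (∑-map Fin.suc (allFin n) f)))

Fin-enumeration : ∀ n → Enumeration {Fin n} _≡_
Fin-enumeration n = record { _≟_ = Fin._≟_ ; elems = allFin n ; once = once }
  where
  once : ∀ {n} (j : Fin n) → ∑ (allFin n) (λ i → ⟦ i Fin.≟ j ⟧) ≡ 1ℚ
  once {suc n} Fin.zero = trans (∑-allFin-suc n (λ i → ⟦ i Fin.≟ Fin.zero ⟧))
    (cong (1ℚ +_) (∑-zero (allFin n) (λ _ → refl)))
  once {suc n} (Fin.suc j) = begin
    ∑ (allFin (suc n)) (λ i → ⟦ i Fin.≟ Fin.suc j ⟧)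
      ≡⟨ ∑-allFin-suc n _ ⟩
    0ℚ + ∑ (allFin n) (λ i → ⟦ Fin.suc i Fin.≟ Fin.suc j ⟧)
      ≡⟨ ℚₚ.+-identityˡ _ ⟩
    ∑ (allFin n) (λ i → ⟦ Fin.suc i Fin.≟ Fin.suc j ⟧)
      ≡⟨ ∑-cong (allFin n) (λ i → ⟦⟧-cong (Fin.suc i Fin.≟ Fin.suc j) (i Fin.≟ j) Finₚ.suc-injective (cong Fin.suc)) ⟩
    ∑ (allFin n) (λ i → ⟦ i Fin.≟ j ⟧)
      ≡⟨ once j ⟩
    1ℚ
      ∎

least : ∀ {n} {P : Pred (Fin n) 0ℓ} → Decidable P → ∃ P → ∃ λ i → P i × (∀ j → P j → i Fin.≤ j)
least {suc n} P? (i , Pi) with P? Fin.zero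
... | yes P0 = Fin.zero , P0 , λ _ _ → ℕ.z≤n
least {suc n} P? (Fin.zero  , P0) | no ¬P0 = contradiction P0 ¬P0
least {suc n} P? (Fin.suc i , Pi) | no ¬P0 with least (P? ∘ Fin.suc) (i , Pi)
... | k , Pk , k-least = Fin.suc k , Pk , λ where
  Fin.zero    P0 → contradiction P0 ¬P0
  (Fin.suc j) Pj → ℕ.s≤s (k-least j Pj)

-- The matrix of `D` is upper triangular with ones on the diagonal, so back substitution works: the
-- tail is solved first, and row zero then determines the one remaining unknown.
triangular-solve : ∀ {n} {D : Fin n → Fin n → Set} (D? : ∀ i j → Dec (D i j)) →
  (∀ i → D i i) → (∀ {i j} → D i j → i Fin.≤ j) →
  (t : Fin n → ℚ) → ∃ λ (h : Fin n → ℚ) → ∀ i → ∑ (allFin n) (λ j → ⟦ D? i j ⟧ * h j) ≡ t i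
triangular-solve {zero}  D? D-refl D⇒≤ t = t , λ ()
triangular-solve {suc n} D? D-refl D⇒≤ t
  with h , h-solves ← triangular-solve (λ i j → D? (Fin.suc i) (Fin.suc j))
         (D-refl ∘ Fin.suc) (ℕ.s≤s⁻¹ ∘ D⇒≤) (t ∘ Fin.suc) = h⁺ , solves
  where
  s : ℚ
  s = ∑ (allFin n) (λ j → ⟦ D? Fin.zero (Fin.suc j) ⟧ * h j)

  h⁺ : Fin (suc n) → ℚ
  h⁺ Fin.zero    = t Fin.zero ℚ.- s
  h⁺ (Fin.suc j) = h j

  solves : ∀ i → ∑ (allFin (suc n)) (λ j → ⟦ D? i j ⟧ * h⁺ j) ≡ t i
  solves Fin.zero = begin
    ∑ (allFin (suc n)) (λ j → ⟦ D? Fin.zero j ⟧ * h⁺ j)   ≡⟨ ∑-allFin-suc n _ ⟩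
    ⟦ D? Fin.zero Fin.zero ⟧ * (t Fin.zero ℚ.- s) + s
      ≡⟨ cong (λ b → b * (t Fin.zero ℚ.- s) + s) (⟦⟧-true (D? Fin.zero Fin.zero) (D-refl Fin.zero)) ⟩
    1ℚ * (t Fin.zero ℚ.- s) + s
      ≡⟨ solve 2 (λ a b → con 1ℚ :* (a :- b) :+ b := a) refl (t Fin.zero) s ⟩
    t Fin.zero                                            ∎
  solves (Fin.suc i) = begin
    ∑ (allFin (suc n)) (λ j → ⟦ D? (Fin.suc i) j ⟧ * h⁺ j)
      ≡⟨ ∑-allFin-suc n _ ⟩
    ⟦ D? (Fin.suc i) Fin.zero ⟧ * h⁺ Fin.zero + ∑ (allFin n) (λ j → ⟦ D? (Fin.suc i) (Fin.suc j) ⟧ * h j)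
      ≡⟨ cong₂ (λ b c → b * h⁺ Fin.zero + c) (⟦⟧-false (D? (Fin.suc i) Fin.zero) (λ d → ℕₚ.n≮0 (D⇒≤ d))) (h-solves i) ⟩
    0ℚ * h⁺ Fin.zero + t (Fin.suc i)
      ≡⟨ cong (_+ t (Fin.suc i)) (ℚₚ.*-zeroˡ (h⁺ Fin.zero)) ⟩
    0ℚ + t (Fin.suc i)
      ≡⟨ ℚₚ.+-identityˡ _ ⟩
    t (Fin.suc i)
      ∎

-- Arithmetic of residues.

%-+-cong : ∀ n .{{_ : NonZero n}} {a b c d} → a % n ≡ b % n → c % n ≡ d % n → (a ℕ.+ c) % n ≡ (b ℕ.+ d) % n
%-+-cong n {a} {b} {c} {d} a≡b c≡d =
  trans (%-distribˡ-+ a c n) (trans (cong₂ (λ x y → (x ℕ.+ y) % n) a≡b c≡d) (sym (%-distribˡ-+ b d n)))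

-- Adding `k * (n - 1)` amounts to subtracting `k` modulo `n`; this gives subtraction of residues
-- within the natural numbers.
[m+k]+k*[n-1]≡m : ∀ n .{{_ : NonZero n}} m k → (m ℕ.+ k ℕ.+ k ℕ.* ℕ.pred n) % n ≡ m % n
[m+k]+k*[n-1]≡m n m k = begin
  (m ℕ.+ k ℕ.+ k ℕ.* ℕ.pred n) % n    ≡⟨ cong (_% n) (ℕₚ.+-assoc m k _) ⟩
  (m ℕ.+ (k ℕ.+ k ℕ.* ℕ.pred n)) % n  ≡⟨ cong (λ z → (m ℕ.+ z) % n) (ℕₚ.*-suc k (ℕ.pred n)) ⟨
  (m ℕ.+ k ℕ.* suc (ℕ.pred n)) % n    ≡⟨ cong (λ z → (m ℕ.+ k ℕ.* z) % n) (ℕₚ.suc-pred n) ⟩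
  (m ℕ.+ k ℕ.* n) % n                 ≡⟨ [m+kn]%n≡m%n m k n ⟩
  m % n                               ∎

%-+-cancelʳ : ∀ n .{{_ : NonZero n}} {a b} c → (a ℕ.+ c) % n ≡ (b ℕ.+ c) % n → a % n ≡ b % n
%-+-cancelʳ n {a} {b} c a+c≡b+c = trans (sym ([m+k]+k*[n-1]≡m n a c))
  (trans (%-+-cong n a+c≡b+c refl) ([m+k]+k*[n-1]≡m n b c))

-- Principal left ideals and sums over left ideals.

module _ (R : FiniteRing) where

  open FiniteRing R
    using (Carrier; _≈_; 0#; 1#; -_; size; toElem; index; index-cong; toElem-index; index-toElem; ring)
    renaming ( _+_ to _⊕_; _*_ to _⊛_; refl to ≈-refl; sym to ≈-sym; trans to ≈-trans; reflexive to ≈-reflexive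
             ; +-cong to ⊕-cong; *-cong to ⊛-cong; +-assoc to ⊕-assoc; *-assoc to ⊛-assoc; distribʳ to ⊛-distribʳ
             ; +-identityʳ to ⊕-identityʳ; +-identityˡ to ⊕-identityˡ; *-identityˡ to ⊛-identityˡ
             ; -‿inverseʳ to ⊕-inverseʳ; -‿inverseˡ to ⊕-inverseˡ; zeroˡ to ⊛-zeroˡ; zeroʳ to ⊛-zeroʳ )
  open RingProperties ring using (-1*x≈-x)

  private instance
    size≢0 : NonZero size
    size≢0 = size-nonZero R

  R-enumeration : Enumeration _≈_
  R-enumeration = record { _≟_ = _≈?_ R ; elems = map toElem (allFin size) ; once = once }
    where
    once : ∀ y → ∑ (map toElem (allFin size)) (λ x → ⟦ _≈?_ R x y ⟧) ≡ 1ℚ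
    once y = begin
      ∑ (map toElem (allFin size)) (λ x → ⟦ _≈?_ R x y ⟧)
        ≡⟨ ∑-map toElem (allFin size) _ ⟩
      ∑ (allFin size) (λ i → ⟦ _≈?_ R (toElem i) y ⟧)
        ≡⟨ ∑-cong (allFin size) (λ i → ⟦⟧-cong (_≈?_ R (toElem i) y) (i Fin.≟ index y)
             (λ i≈y → trans (sym (index-toElem i)) (index-cong i≈y))
             (λ i≡y → ≈-trans (≈-reflexive (cong toElem i≡y)) (toElem-index y))) ⟩
      ∑ (allFin size) (λ i → ⟦ i Fin.≟ index y ⟧)
        ≡⟨ Enumeration.once (Fin-enumeration size) (index y) ⟩
      1ℚ ∎

  private module 𝓡 = Enumeration R-enumeration

  sumR≡∑ : {P : Pred Carrier 0ℓ} (P? : Decidable P) (f : Carrier → ℚ) →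
    sumR R P? f ≡ ∑ 𝓡.elems (λ x → ⟦ P? x ⟧ * f x)
  sumR≡∑ P? f = trans (foldr≡∑ (filter (P? ∘ toElem) (allFin size)) (f ∘ toElem))
    (trans (∑-filter (P? ∘ toElem) (allFin size) (f ∘ toElem)) (sym (∑-map toElem (allFin size) _)))

  toℚ-countR : {P : Pred Carrier 0ℓ} (P? : Decidable P) → toℚ (countR R P?) ≡ ∑ 𝓡.elems (λ x → ⟦ P? x ⟧)
  toℚ-countR P? = trans (toℚ-length-filter (P? ∘ toElem) (allFin size)) (sym (∑-map toElem (allFin size) _))

  ⊕-shift : ∀ t {x y} → x ≈ y ⊕ t → y ≈ x ⊕ (- t)
  ⊕-shift t {x} {y} x≈y+t = ≈-sym (≈-trans (⊕-cong x≈y+t ≈-refl)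
    (≈-trans (⊕-assoc y t (- t)) (≈-trans (⊕-cong ≈-refl (⊕-inverseʳ t)) (⊕-identityʳ y))))

  ⊕-unshift : ∀ t {x y} → y ≈ x ⊕ (- t) → x ≈ y ⊕ t
  ⊕-unshift t {x} {y} y≈x-t = ≈-sym (≈-trans (⊕-cong y≈x-t ≈-refl)
    (≈-trans (⊕-assoc x (- t) t) (≈-trans (⊕-cong ≈-refl (⊕-inverseˡ t)) (⊕-identityʳ x))))

  InRx-refl : ∀ x → InRx R x x
  InRx-refl x = 1# , ⊛-identityˡ x

  InRx-reflexive : ∀ {x y} → x ≈ y → InRx R x y
  InRx-reflexive {x} x≈y = 1# , ≈-trans (⊛-identityˡ x) x≈y

  InRx-trans : ∀ {x y z} → InRx R x y → InRx R y z → InRx R x z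
  InRx-trans {x} (r , rx≈y) (s , sy≈z) =
    s ⊛ r , ≈-trans (⊛-assoc s r x) (≈-trans (⊛-cong ≈-refl rx≈y) sy≈z)

  InRx-isLeftIdeal : ∀ x → IsLeftIdeal R (InRx R x)
  InRx-isLeftIdeal x = record
    { resp       = λ y≈z (r , rx≈y) → r , ≈-trans rx≈y y≈z
    ; zero∈      = 0# , ⊛-zeroˡ x
    ; +-closed   = λ (r , rx≈y) (s , sx≈z) → r ⊕ s , ≈-trans (⊛-distribʳ x r s) (⊕-cong rx≈y sx≈z)
    ; neg-closed = λ {y} (r , rx≈y) → - 1# ⊛ r ,
        ≈-trans (⊛-assoc (- 1#) r x) (≈-trans (⊛-cong ≈-refl rx≈y) (-1*x≈-x y))
    ; *-closedˡ  = λ s (r , rx≈y) → s ⊛ r , ≈-trans (⊛-assoc s r x) (⊛-cong ≈-refl rx≈y)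
    }

  private
    -- Both elements generate the same left ideal; every left ideal is a union of classes of this
    -- relation.
    _~_ : Carrier → Carrier → Set
    x ~ y = InRx R x y × InRx R y x

    _~?_ : ∀ x y → Dec (x ~ y)
    x ~? y = inRx? R x y ×-dec inRx? R y x

    ~-sym : ∀ {x y} → x ~ y → y ~ x
    ~-sym (p , q) = q , p

    ~-trans : ∀ {x y z} → x ~ y → y ~ z → x ~ z
    ~-trans (p , q) (p′ , q′) = InRx-trans p p′ , InRx-trans q′ q

    ≈⇒~ : ∀ {x y} → x ≈ y → x ~ y
    ≈⇒~ x≈y = InRx-reflexive x≈y , InRx-reflexive (≈-sym x≈y)

    -- Proper inclusion of principal left ideals, stated on indices because `spo-wellFounded`
    -- concerns strict partial orders on `Fin`.
    _⊏_ : Fin size → Fin size → Set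
    i ⊏ j = InRx R (toElem j) (toElem i) × ¬ InRx R (toElem i) (toElem j)

    ⊏-wellFounded : WellFounded _⊏_
    ⊏-wellFounded = spo-wellFounded record
      { isEquivalence = isEquivalence
      ; irrefl        = λ { refl (p , ¬p) → ¬p p }
      ; trans         = λ (p , ¬p) (q , ¬q) → InRx-trans q p , λ r → ¬q (InRx-trans p r)
      ; <-resp-≈      = (λ { refl p → p }) , (λ { refl p → p })
      }

    index-⊏ : ∀ {x y} → InRx R x y → ¬ InRx R y x → index y ⊏ index x
    index-⊏ {x} {y} p ¬p =
      InRx-trans (InRx-reflexive (toElem-index x)) (InRx-trans p (InRx-reflexive (≈-sym (toElem-index y)))) ,
      λ q → ¬p (InRx-trans (InRx-reflexive (≈-sym (toElem-index y))) (InRx-trans q (InRx-reflexive (toElem-index x))))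

  -- The indicator of a left ideal is an integer combination of indicators of principal left ideals.
  null-on-principal⇒null : (g : Carrier → ℚ) →
    (∀ x → ∑ 𝓡.elems (λ y → ⟦ inRx? R x y ⟧ * g y) ≡ 0ℚ) →
    {I : Pred Carrier 0ℓ} (I? : Decidable I) → IsLeftIdeal R I →
    ∑ 𝓡.elems (λ y → ⟦ I? y ⟧ * g y) ≡ 0ℚ
  null-on-principal⇒null g principal-null I? I-ideal =
    𝓡.∑-classes _~?_ ~-sym ~-trans ≈⇒~ g I? (λ ((r , rx≈y) , _) Ix → resp rx≈y (*-closedˡ r Ix))
      (λ x _ → class-null x (⊏-wellFounded (index x)))
    where
    open IsLeftIdeal I-ideal

    -- Well-founded induction on Rx. The class of `x` is the set of generators of Rx; every other
    -- element of Rx generates a properly smaller ideal, so the rest of Rx is a union of classes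
    -- that are null by induction. Since Rx is null, so is the class of `x`.
    class-null : ∀ x → Acc _⊏_ (index x) → ∑ 𝓡.elems (λ y → ⟦ x ~? y ⟧ * g y) ≡ 0ℚ
    class-null x (acc smaller) = begin
      ∑ 𝓡.elems (λ y → ⟦ x ~? y ⟧ * g y)
        ≡⟨ ℚₚ.+-identityʳ _ ⟨
      ∑ 𝓡.elems (λ y → ⟦ x ~? y ⟧ * g y) + 0ℚ
        ≡⟨ cong (∑ 𝓡.elems (λ y → ⟦ x ~? y ⟧ * g y) +_) rest-null ⟨
      ∑ 𝓡.elems (λ y → ⟦ x ~? y ⟧ * g y) + ∑ 𝓡.elems (λ y → ⟦ inRx? R x y ×-dec ¬? (x ~? y) ⟧ * g y)
        ≡⟨ 𝓡.∑-split (inRx? R x) (x ~?_) proj₁ g ⟨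
      ∑ 𝓡.elems (λ y → ⟦ inRx? R x y ⟧ * g y)
        ≡⟨ principal-null x ⟩
      0ℚ ∎
      where
      rest-null : ∑ 𝓡.elems (λ y → ⟦ inRx? R x y ×-dec ¬? (x ~? y) ⟧ * g y) ≡ 0ℚ
      rest-null = 𝓡.∑-classes _~?_ ~-sym ~-trans ≈⇒~ g (λ y → inRx? R x y ×-dec ¬? (x ~? y))
        (λ y~z (p , x≁y) → InRx-trans p (proj₁ y~z) , λ x~z → x≁y (~-trans x~z (~-sym y~z)))
        (λ y (p , x≁y) → class-null y (smaller (index-⊏ p (λ q → x≁y (p , q)))))

  -- A rational substitute for a complex character.

  module _ (χ : Carrier → ℕ) (χ-char : IsCharacter R χ) where

    private
      χ-cong : ∀ {x y} → x ≈ y → χ x % size ≡ χ y % size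
      χ-cong = proj₁ χ-char

      χ-⊕ : ∀ x y {m n} → χ x % size ≡ m % size → χ y % size ≡ n % size → χ (x ⊕ y) % size ≡ (m ℕ.+ n) % size
      χ-⊕ x y χx≡m χy≡n = trans (proj₂ χ-char x y) (%-+-cong size χx≡m χy≡n)

      χ-0# : χ 0# % size ≡ 0 % size
      χ-0# = sym (%-+-cancelʳ size (χ 0#) (trans (sym (χ-cong (⊕-identityʳ 0#))) (proj₂ χ-char 0# 0#)))

      χ≡? : ∀ m x → Dec (χ x % size ≡ m % size)
      χ≡? m x = χ x % size ℕ.≟ m % size

      -- An index `i` stands for the number `suc (Fin.toℕ i)`. The range is thus 1 to N = `size`,
      -- with N in the role of residue 0, and on positive numbers divisibility implies ≤, as
      -- `triangular-solve` demands.
      divisor? : (i j : Fin size) → Dec (suc (Fin.toℕ i) ∣ suc (Fin.toℕ j))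
      divisor? i j = suc (Fin.toℕ i) ∣? suc (Fin.toℕ j)

      -- The prescribed sum of `h` over the multiples of g among 1, ..., N: it is 1 for g = N, which
      -- corresponds to the trivial subgroup, and 0 for smaller g.
      full : Fin size → ℚ
      full i = ⟦ suc (Fin.toℕ i) ℕ.≟ size ⟧

      solution : ∃ λ (h : Fin size → ℚ) → ∀ i → ∑ (allFin size) (λ j → ⟦ divisor? i j ⟧ * h j) ≡ full i
      solution = triangular-solve divisor? (λ _ → ∣-refl) (λ i∣j → ℕ.s≤s⁻¹ (∣⇒≤ i∣j)) full

      h : Fin size → ℚ
      h = proj₁ solution

    -- A rational stand-in for the complex character exp(2πiχ/N): a function of the residue of χ
    -- that sums to zero over every nontrivial subgroup gℤ/N of ℤ/N and takes the value 1 at 0.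
    -- These conditions on the divisors g of N are triangular with respect to divisibility, which gives h.
    ψ : Carrier → ℚ
    ψ x = ∑ (allFin size) (λ i → ⟦ χ≡? (suc (Fin.toℕ i)) x ⟧ * h i)

    ψ-cong : ∀ {x y} → x ≈ y → ψ x ≡ ψ y
    ψ-cong {x} {y} x≈y = ∑-cong (allFin size) λ i → cong (_* h i)
      (⟦⟧-cong (χ≡? _ x) (χ≡? _ y) (trans (sym (χ-cong x≈y))) (trans (χ-cong x≈y)))

    private
      last : Fin size
      last = Fin.fromℕ< (ℕₚ.≤-reflexive (ℕₚ.suc-pred size))

      suc-last : suc (Fin.toℕ last) ≡ size
      suc-last = trans (cong suc (Finₚ.toℕ-fromℕ< (ℕₚ.≤-reflexive (ℕₚ.suc-pred size)))) (ℕₚ.suc-pred size)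

    -- As `χ 0#` has residue 0, exactly the indices of multiples of N contribute, so the sum is the
    -- left side of the equation for `h` at N.
    ψ-0# : ψ 0# ≡ 1ℚ
    ψ-0# = begin
      ∑ (allFin size) (λ i → ⟦ χ≡? (suc (Fin.toℕ i)) 0# ⟧ * h i)
        ≡⟨ ∑-cong (allFin size) (λ i → cong (_* h i) (⟦⟧-cong (χ≡? (suc (Fin.toℕ i)) 0#) (divisor? last i)
             (λ e → subst (_∣ suc (Fin.toℕ i)) (sym suc-last) (m%n≡0⇒n∣m (suc (Fin.toℕ i)) size (trans (sym e) (trans χ-0# (m*n%n≡0 0 size)))))
             (λ d → trans χ-0# (trans (m*n%n≡0 0 size) (sym (n∣m⇒m%n≡0 (suc (Fin.toℕ i)) size (subst (_∣ suc (Fin.toℕ i)) suc-last d))))))) ⟩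
      ∑ (allFin size) (λ i → ⟦ divisor? last i ⟧ * h i)
        ≡⟨ proj₂ solution last ⟩
      full last
        ≡⟨ ⟦⟧-true (suc (Fin.toℕ last) ℕ.≟ size) suc-last ⟩
      1ℚ ∎

    -- Group the elements of `I` by the residue of `χ`. The attained residues are the multiples of
    -- some g and all their fibres have equal size, so the sum is `fiber 0` times the left side of
    -- the equation for `h` at g. Nontriviality of `χ` on `I` gives g ≠ N, where the right side is
    -- 0.
    ψ-null : {I : Pred Carrier 0ℓ} (I? : Decidable I) → IsLeftIdeal R I → ¬ (∀ x → I x → InKernel R χ x) →
      ∑ 𝓡.elems (λ x → ⟦ I? x ⟧ * ψ x) ≡ 0ℚ
    ψ-null {I} I? I-ideal χ-nontrivial = begin
      ∑ 𝓡.elems (λ x → ⟦ I? x ⟧ * ψ x)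
        ≡⟨ ∑-cong 𝓡.elems (λ x → ∑-*ˡ ⟦ I? x ⟧ (allFin size) _) ⟨
      ∑ 𝓡.elems (λ x → ∑ (allFin size) (λ i → ⟦ I? x ⟧ * (⟦ χ≡? (suc (Fin.toℕ i)) x ⟧ * h i)))
        ≡⟨ ∑-comm 𝓡.elems (allFin size) _ ⟩
      ∑ (allFin size) (λ i → ∑ 𝓡.elems (λ x → ⟦ I? x ⟧ * (⟦ χ≡? (suc (Fin.toℕ i)) x ⟧ * h i)))
        ≡⟨ ∑-cong (allFin size) (λ i → trans (∑-cong 𝓡.elems (λ x → trans (sym (ℚₚ.*-assoc ⟦ I? x ⟧ ⟦ χ≡? (suc (Fin.toℕ i)) x ⟧ (h i)))
             (cong (_* h i) (sym (⟦⟧-× (I? x) (χ≡? (suc (Fin.toℕ i)) x)))))) (∑-*ʳ (h i) 𝓡.elems _)) ⟩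
      ∑ (allFin size) (λ i → fiber (suc (Fin.toℕ i)) * h i)
        ≡⟨ ∑-cong (allFin size) (λ i → trans (cong (_* h i) (fiber-size i)) (ℚₚ.*-assoc (fiber 0) _ (h i))) ⟩
      ∑ (allFin size) (λ i → fiber 0 * (⟦ divisor? g i ⟧ * h i))
        ≡⟨ ∑-*ˡ (fiber 0) (allFin size) _ ⟩
      fiber 0 * ∑ (allFin size) (λ i → ⟦ divisor? g i ⟧ * h i)
        ≡⟨ cong (fiber 0 *_) (trans (proj₂ solution g) (⟦⟧-false (suc (Fin.toℕ g) ℕ.≟ size) g-proper)) ⟩
      fiber 0 * 0ℚ
        ≡⟨ ℚₚ.*-zeroʳ (fiber 0) ⟩
      0ℚ ∎
      where
      open IsLeftIdeal I-ideal

      Attained : ℕ → Set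
      Attained m = ∃ λ x → I x × χ x % size ≡ m % size

      attained? : ∀ m → Dec (Attained m)
      attained? m = 𝓡.search (λ x → I? x ×-dec χ≡? m x)
        (λ x≈y (Iy , χy≡m) → resp (≈-sym x≈y) Iy , trans (χ-cong x≈y) χy≡m)

      attained-0 : Attained 0
      attained-0 = 0# , zero∈ , χ-0#

      attained-+ : ∀ {m n} → Attained m → Attained n → Attained (m ℕ.+ n)
      attained-+ (x , Ix , χx≡m) (y , Iy , χy≡n) = x ⊕ y , +-closed Ix Iy , χ-⊕ x y χx≡m χy≡n

      attained-* : ∀ k {m} → Attained m → Attained (k ℕ.* m)
      attained-* zero    _ = attained-0
      attained-* (suc k) a = attained-+ a (attained-* k a)

      attained-cong : ∀ {m n} → m % size ≡ n % size → Attained m → Attained n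
      attained-cong m≡n (x , Ix , χx≡m) = x , Ix , trans χx≡m m≡n

      -- Adding `n` to itself `ℕ.pred size` times produces its negative modulo `size`.
      attained-cancel : ∀ m n → Attained (m ℕ.+ n) → Attained n → Attained m
      attained-cancel m n a b = attained-cong ([m+k]+k*[n-1]≡m size m n)
        (attained-+ a (subst Attained (ℕₚ.*-comm (ℕ.pred size) n) (attained-* (ℕ.pred size) b)))

      least-attained : ∃ λ (i : Fin size) → Attained (suc (Fin.toℕ i)) × (∀ j → Attained (suc (Fin.toℕ j)) → i Fin.≤ j)
      least-attained = least (λ i → attained? (suc (Fin.toℕ i)))
        -- The search has a starting point because N has residue 0, which is the value at `0#`.
        (last , attained-cong (trans (m*n%n≡0 0 size) (sym (trans (cong (_% size) suc-last) (n%n≡0 size)))) attained-0)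

      g : Fin size
      g = proj₁ least-attained

      g⁺ : ℕ
      g⁺ = suc (Fin.toℕ g)

      -- Division with remainder: the remainder of `m` by `g⁺` is again attained and lies below
      -- `g⁺`, so by minimality it is 0.
      attained⇒∣ : ∀ m → Attained m → g⁺ ∣ m
      attained⇒∣ m a = m%n≡0⇒n∣m m g⁺ (remainder (m % g⁺) (m%n<n m g⁺)
        (attained-cancel (m % g⁺) (m ℕ./ g⁺ ℕ.* g⁺) (subst Attained (m≡m%n+[m/n]*n m g⁺) a)
          (attained-* (m ℕ./ g⁺) (proj₁ (proj₂ least-attained)))))
        where
        remainder : ∀ ρ → ρ ℕ.< g⁺ → Attained ρ → ρ ≡ 0
        remainder zero    _    _ = refl
        remainder (suc ρ) ρ<g⁺ a = contradiction
          (subst (Fin.toℕ g ℕ.≤_) (Finₚ.toℕ-fromℕ< ρ<N)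
            (proj₂ (proj₂ least-attained) (Fin.fromℕ< ρ<N) (subst (Attained ∘ suc) (sym (Finₚ.toℕ-fromℕ< ρ<N)) a)))
          (ℕₚ.<⇒≱ ρ<g)
          where
          ρ<g : ρ ℕ.< Fin.toℕ g
          ρ<g = ℕ.s≤s⁻¹ ρ<g⁺
          ρ<N : ρ ℕ.< size
          ρ<N = ℕₚ.<-trans ρ<g (Finₚ.toℕ<n g)

      ∣⇒attained : ∀ {m} → g⁺ ∣ m → Attained m
      ∣⇒attained (divides q m≡q*g⁺) = subst Attained (sym m≡q*g⁺) (attained-* q (proj₁ (proj₂ least-attained)))

      -- If `g⁺` were N, every value of `χ` on `I` would be divisible by N, putting `I` inside the
      -- kernel.
      g-proper : g⁺ ≢ size
      g-proper g⁺≡size = χ-nontrivial λ x Ix →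
        n∣m⇒m%n≡0 (χ x) size (subst (_∣ χ x) g⁺≡size (attained⇒∣ (χ x) (x , Ix , refl)))

      fiber : ℕ → ℚ
      fiber m = ∑ 𝓡.elems (λ x → ⟦ I? x ×-dec χ≡? m x ⟧)

      -- Translation by an element `t` of `I` whose value has residue `m` carries the fibre over 0
      -- onto the fibre over `m`.
      fiber-attained : ∀ m → Attained m → fiber m ≡ fiber 0
      fiber-attained m (t , It , χt≡m) = 𝓡.count-shift (_⊕ t) (_⊕ (- t)) (⊕-shift t) (⊕-unshift t)
        (λ x → I? x ×-dec χ≡? 0 x) (λ x → I? x ×-dec χ≡? m x)
        (λ x≈y (Ix , e) → resp x≈y Ix , trans (sym (χ-cong x≈y)) e)
        (λ x≈y (Iy , e) → resp (≈-sym x≈y) Iy , trans (χ-cong x≈y) e)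
        (λ x (Ix , χx≡0) → +-closed Ix It , χ-⊕ x t χx≡0 χt≡m)
        (λ x (Ix+t , e) → resp (≈-sym (⊕-shift t ≈-refl)) (+-closed Ix+t (neg-closed It)) ,
          %-+-cancelʳ size m (trans (sym (χ-⊕ x t refl χt≡m)) e))

      fiber-size : ∀ i → fiber (suc (Fin.toℕ i)) ≡ fiber 0 * ⟦ divisor? g i ⟧
      fiber-size i = by-divisibility (divisor? g i)
        where
        by-divisibility : (d : Dec (g⁺ ∣ suc (Fin.toℕ i))) → fiber (suc (Fin.toℕ i)) ≡ fiber 0 * ⟦ d ⟧
        by-divisibility (yes g∣i) = trans (fiber-attained _ (∣⇒attained g∣i)) (sym (ℚₚ.*-identityʳ (fiber 0)))
        by-divisibility (no  g∤i) = trans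
          (∑-zero 𝓡.elems (λ x → ⟦⟧-false (I? x ×-dec χ≡? _ x) (λ (Ix , e) → g∤i (attained⇒∣ _ (x , Ix , e)))))
          (sym (ℚₚ.*-zeroʳ (fiber 0)))

  -- Words and basic examples of linear codes.

  Word-enumeration : ∀ n → Enumeration (_≈ᵛ_ R {n})
  Word-enumeration n = record { _≟_ = _≈ᵛ?_ R ; elems = allWords R n ; once = once n }
    where
    once : ∀ n (v : Word R n) → ∑ (allWords R n) (λ u → ⟦ _≈ᵛ?_ R u v ⟧) ≡ 1ℚ
    once zero    []      = trans (∑-∷ [] [] _) (cong₂ _+_ (⟦⟧-true (_≈ᵛ?_ R [] []) (λ ())) ∑-[])
    once (suc n) (y ∷ v) = begin
      ∑ (allWords R (suc n)) (λ u → ⟦ _≈ᵛ?_ R u (y ∷ v) ⟧)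
        ≡⟨ ∑-concatMap (λ i → map (toElem i ∷_) (allWords R n)) (allFin size) _ ⟩
      ∑ (allFin size) (λ i → ∑ (map (toElem i ∷_) (allWords R n)) (λ u → ⟦ _≈ᵛ?_ R u (y ∷ v) ⟧))
        ≡⟨ ∑-cong (allFin size) (λ i → ∑-map (toElem i ∷_) (allWords R n) _) ⟩
      ∑ (allFin size) (λ i → ∑ (allWords R n) (λ u → ⟦ _≈ᵛ?_ R (toElem i ∷ u) (y ∷ v) ⟧))
        ≡⟨ ∑-cong (allFin size) (λ i → trans (∑-cong (allWords R n) (λ u → ∷-indicator (toElem i) u))
             (∑-*ˡ ⟦ _≈?_ R (toElem i) y ⟧ (allWords R n) (λ u → ⟦ _≈ᵛ?_ R u v ⟧))) ⟩
      ∑ (allFin size) (λ i → ⟦ _≈?_ R (toElem i) y ⟧ * ∑ (allWords R n) (λ u → ⟦ _≈ᵛ?_ R u v ⟧))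
        ≡⟨ ∑-cong (allFin size) (λ i → trans (cong (⟦ _≈?_ R (toElem i) y ⟧ *_) (once n v)) (ℚₚ.*-identityʳ _)) ⟩
      ∑ (allFin size) (λ i → ⟦ _≈?_ R (toElem i) y ⟧)
        ≡⟨ ∑-map toElem (allFin size) (λ x → ⟦ _≈?_ R x y ⟧) ⟨
      ∑ 𝓡.elems (λ x → ⟦ _≈?_ R x y ⟧)
        ≡⟨ 𝓡.once y ⟩
      1ℚ ∎
      where
      ∷-indicator : ∀ x u → ⟦ _≈ᵛ?_ R (x ∷ u) (y ∷ v) ⟧ ≡ ⟦ _≈?_ R x y ⟧ * ⟦ _≈ᵛ?_ R u v ⟧
      ∷-indicator x u = trans
        (⟦⟧-cong (_≈ᵛ?_ R (x ∷ u) (y ∷ v)) (_≈?_ R x y ×-dec _≈ᵛ?_ R u v)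
          (λ e → e Fin.zero , e ∘ Fin.suc)
          (λ { (x≈y , u≈v) Fin.zero → x≈y ; (x≈y , u≈v) (Fin.suc i) → u≈v i }))
        (⟦⟧-× (_≈?_ R x y) (_≈ᵛ?_ R u v))

  lookup-+ᵛ : ∀ {n} (u v : Word R n) j → lookup (_+ᵛ_ R u v) j ≈ lookup u j ⊕ lookup v j
  lookup-+ᵛ u v j = ≈-reflexive (lookup-zipWith _⊕_ j u v)

  lookup-·ᵛ : ∀ {n} r (v : Word R n) j → lookup (_·ᵛ_ R r v) j ≈ r ⊛ lookup v j
  lookup-·ᵛ r v j = ≈-reflexive (lookup-map j (r ⊛_) v)

  lookup-0ᵛ : ∀ {n} (j : Fin n) → lookup (0ᵛ R) j ≈ 0#
  lookup-0ᵛ j = ≈-reflexive (lookup-replicate j 0#)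

  wtᵛ≡∑ : (w : Carrier → ℚ) → ∀ {n} (v : Word R n) → wtᵛ R w v ≡ ∑ (allFin n) (λ j → w (lookup v j))
  wtᵛ≡∑ w []      = sym ∑-[]
  wtᵛ≡∑ w {suc n} (x ∷ v) = trans (cong (w x +_) (wtᵛ≡∑ w v)) (sym (∑-allFin-suc n (λ j → w (lookup (x ∷ v) j))))

  InRc-isLinearCode : ∀ {n} (c : Word R n) → IsLinearCode R n (InRc R c)
  InRc-isLinearCode c = record
    { resp     = λ u≈v (r , rc≈u) → r , λ j → ≈-trans (rc≈u j) (u≈v j)
    ; zero∈    = 0# , λ j → ≈-trans (lookup-·ᵛ 0# c j) (≈-trans (⊛-zeroˡ _) (≈-sym (lookup-0ᵛ j)))
    ; +-closed = λ {u} {v} (r , rc≈u) (s , sc≈v) → r ⊕ s , λ j →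
        ≈-trans (lookup-·ᵛ (r ⊕ s) c j) (≈-trans (⊛-distribʳ _ r s) (≈-trans
          (⊕-cong (≈-trans (≈-sym (lookup-·ᵛ r c j)) (rc≈u j)) (≈-trans (≈-sym (lookup-·ᵛ s c j)) (sc≈v j)))
          (≈-sym (lookup-+ᵛ u v j))))
    ; ·-closed = λ r {u} (s , sc≈u) → r ⊛ s , λ j →
        ≈-trans (lookup-·ᵛ (r ⊛ s) c j) (≈-trans (⊛-assoc r s _) (≈-trans
          (⊛-cong ≈-refl (≈-trans (≈-sym (lookup-·ᵛ s c j)) (sc≈u j))) (≈-sym (lookup-·ᵛ r u j))))
    }

  -- The zero code is the subcode compared with `C` in the proof that `γ` is nonnegative.
  zeroCode-isLinear : ∀ {n} → IsLinearCode R n (λ v → _≈ᵛ_ R v (0ᵛ R))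
  zeroCode-isLinear = record
    { resp     = λ u≈v u≈0 j → ≈-trans (≈-sym (u≈v j)) (u≈0 j)
    ; zero∈    = λ _ → ≈-refl
    ; +-closed = λ {u} {v} u≈0 v≈0 j → ≈-trans (lookup-+ᵛ u v j)
        (≈-trans (⊕-cong (≈-trans (u≈0 j) (lookup-0ᵛ j)) (v≈0 j)) (⊕-identityˡ _))
    ; ·-closed = λ r {u} u≈0 j → ≈-trans (lookup-·ᵛ r u j)
        (≈-trans (⊛-cong ≈-refl (≈-trans (u≈0 j) (lookup-0ᵛ j))) (≈-trans (⊛-zeroʳ r) (≈-sym (lookup-0ᵛ j))))
    }

  -- Coordinate projections of a linear code.

  module LinearCode {n : ℕ} {D : Pred (Word R n) 0ℓ} (D? : Decidable D) (D-linear : IsLinearCode R n D) where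

    open IsLinearCode D-linear
    private module 𝓦 = Enumeration (Word-enumeration n)

    card : ℚ
    card = ∑ 𝓦.elems (λ v → ⟦ D? v ⟧)

    Coordinate : Fin n → Pred Carrier 0ℓ
    Coordinate j x = ∃ λ v → D v × x ≈ lookup v j

    coordinate? : ∀ j → Decidable (Coordinate j)
    coordinate? j x = 𝓦.search (λ v → D? v ×-dec _≈?_ R x (lookup v j))
      (λ u≈v (Dv , x≈vⱼ) → resp (λ i → ≈-sym (u≈v i)) Dv , ≈-trans x≈vⱼ (≈-sym (u≈v j)))

    coordinate-isLeftIdeal : ∀ j → IsLeftIdeal R (Coordinate j)
    coordinate-isLeftIdeal j = record
      { resp       = λ x≈y (v , Dv , x≈vⱼ) → v , Dv , ≈-trans (≈-sym x≈y) x≈vⱼ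
      ; zero∈      = 0ᵛ R , zero∈ , ≈-sym (lookup-0ᵛ j)
      ; +-closed   = λ (u , Du , x≈uⱼ) (v , Dv , y≈vⱼ) → _+ᵛ_ R u v , +-closed Du Dv ,
          ≈-trans (⊕-cong x≈uⱼ y≈vⱼ) (≈-sym (lookup-+ᵛ u v j))
      ; neg-closed = λ {x} c → closed-· (- 1#) (≈-sym (-1*x≈-x x)) c
      ; *-closedˡ  = λ r c → closed-· r ≈-refl c
      }
      where
      closed-· : ∀ {x y} r → y ≈ r ⊛ x → Coordinate j x → Coordinate j y
      closed-· r y≈rx (v , Dv , x≈vⱼ) = _·ᵛ_ R r v , ·-closed r Dv ,
        ≈-trans y≈rx (≈-trans (⊛-cong ≈-refl x≈vⱼ) (≈-sym (lookup-·ᵛ r v j)))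

    multiplicity : Fin n → Carrier → ℚ
    multiplicity j x = ∑ 𝓦.elems (λ v → ⟦ D? v ×-dec _≈?_ R x (lookup v j) ⟧)

    -- Adding a codeword `t` with `j`-th coordinate `x` maps the codewords vanishing at `j`
    -- bijectively onto those with entry `x` at `j`.
    multiplicity-coordinate : ∀ j x → Coordinate j x → multiplicity j x ≡ multiplicity j 0#
    multiplicity-coordinate j x (t , Dt , x≈tⱼ) = 𝓦.count-shift (λ v → _+ᵛ_ R v t) (λ v → _+ᵛ_ R v -t) (λ {u} {v} → shift u v) (λ {u} {v} → unshift u v)
      (λ v → D? v ×-dec _≈?_ R 0# (lookup v j)) (λ v → D? v ×-dec _≈?_ R x (lookup v j))
      (λ u≈v (Du , e) → resp u≈v Du , ≈-trans e (u≈v j))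
      (λ u≈v (Dv , e) → resp (≈-sym ∘ u≈v) Dv , ≈-trans e (≈-sym (u≈v j)))
      (λ v (Dv , 0≈vⱼ) → +-closed Dv Dt ,
        ≈-trans (≈-sym (⊕-identityˡ x)) (≈-trans (⊕-cong 0≈vⱼ x≈tⱼ) (≈-sym (lookup-+ᵛ v t j))))
      (λ v (Dv+t , x≈vⱼ+tⱼ) → resp (≈-sym ∘ shift (_+ᵛ_ R v t) v (λ i → ≈-refl)) (+-closed Dv+t (·-closed (- 1#) Dt)) ,
        ≈-trans (≈-sym (⊕-inverseʳ x)) (≈-sym (⊕-shift x (≈-trans x≈vⱼ+tⱼ
          (≈-trans (lookup-+ᵛ v t j) (⊕-cong ≈-refl (≈-sym x≈tⱼ)))))))
      where
      -- The negative is a scalar multiple, so closure of the code under scalars keeps it in the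
      -- code.
      -t : Word R n
      -t = _·ᵛ_ R (- 1#) t

      lookup--t : ∀ (u : Word R n) i → lookup (_+ᵛ_ R u -t) i ≈ lookup u i ⊕ (- lookup t i)
      lookup--t u i = ≈-trans (lookup-+ᵛ u -t i) (⊕-cong ≈-refl (≈-trans (lookup-·ᵛ (- 1#) t i) (-1*x≈-x _)))

      shift : ∀ (u v : Word R n) → _≈ᵛ_ R u (_+ᵛ_ R v t) → _≈ᵛ_ R v (_+ᵛ_ R u -t)
      shift u v u≈v+t i = ≈-trans (⊕-shift (lookup t i) (≈-trans (u≈v+t i) (lookup-+ᵛ v t i))) (≈-sym (lookup--t u i))

      unshift : ∀ (u v : Word R n) → _≈ᵛ_ R v (_+ᵛ_ R u -t) → _≈ᵛ_ R u (_+ᵛ_ R v t)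
      unshift u v v≈u-t i = ≈-trans (⊕-unshift (lookup t i) (≈-trans (v≈u-t i) (lookup--t u i))) (≈-sym (lookup-+ᵛ v t i))

    multiplicity≡ : ∀ j x → multiplicity j x ≡ multiplicity j 0# * ⟦ coordinate? j x ⟧
    multiplicity≡ j x = by-cases (coordinate? j x)
      where
      by-cases : (d : Dec (Coordinate j x)) → multiplicity j x ≡ multiplicity j 0# * ⟦ d ⟧
      by-cases (yes c) = trans (multiplicity-coordinate j x c) (sym (ℚₚ.*-identityʳ (multiplicity j 0#)))
      by-cases (no ¬c) = trans
        (∑-zero 𝓦.elems (λ v → ⟦⟧-false (D? v ×-dec _≈?_ R x (lookup v j)) (λ (Dv , e) → ¬c (v , Dv , e))))
        (sym (ℚₚ.*-zeroʳ (multiplicity j 0#)))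

    -- Group the codewords by their `j`-th entry: each element of the projection occurs equally
    -- often, namely `multiplicity j 0#` times.
    ∑-coordinate : ∀ j (f : Carrier → ℚ) → (∀ {x y} → x ≈ y → f x ≡ f y) →
      ∑ 𝓦.elems (λ v → ⟦ D? v ⟧ * f (lookup v j)) ≡
      multiplicity j 0# * ∑ 𝓡.elems (λ x → ⟦ coordinate? j x ⟧ * f x)
    ∑-coordinate j f f-resp = begin
      ∑ 𝓦.elems (λ v → ⟦ D? v ⟧ * f (lookup v j))
        ≡⟨ ∑-cong 𝓦.elems (λ v → trans (cong (⟦ D? v ⟧ *_) (sym (𝓡.sift (lookup v j) f-resp)))
             (sym (∑-*ˡ ⟦ D? v ⟧ 𝓡.elems _))) ⟩
      ∑ 𝓦.elems (λ v → ∑ 𝓡.elems (λ x → ⟦ D? v ⟧ * (⟦ _≈?_ R x (lookup v j) ⟧ * f x)))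
        ≡⟨ ∑-comm 𝓦.elems 𝓡.elems _ ⟩
      ∑ 𝓡.elems (λ x → ∑ 𝓦.elems (λ v → ⟦ D? v ⟧ * (⟦ _≈?_ R x (lookup v j) ⟧ * f x)))
        ≡⟨ ∑-cong 𝓡.elems (λ x → trans (∑-cong 𝓦.elems (λ v →
             trans (sym (ℚₚ.*-assoc ⟦ D? v ⟧ ⟦ _≈?_ R x (lookup v j) ⟧ (f x)))
               (cong (_* f x) (sym (⟦⟧-× (D? v) (_≈?_ R x (lookup v j)))))))
             (∑-*ʳ (f x) 𝓦.elems _)) ⟩
      ∑ 𝓡.elems (λ x → multiplicity j x * f x)
        ≡⟨ ∑-cong 𝓡.elems (λ x → trans (cong (_* f x) (multiplicity≡ j x))
             (ℚₚ.*-assoc (multiplicity j 0#) ⟦ coordinate? j x ⟧ (f x))) ⟩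
      ∑ 𝓡.elems (λ x → multiplicity j 0# * (⟦ coordinate? j x ⟧ * f x))
        ≡⟨ ∑-*ˡ (multiplicity j 0#) 𝓡.elems _ ⟩
      multiplicity j 0# * ∑ 𝓡.elems (λ x → ⟦ coordinate? j x ⟧ * f x)
        ∎

    card-coordinate : ∀ j → card ≡ multiplicity j 0# * ∑ 𝓡.elems (λ x → ⟦ coordinate? j x ⟧)
    card-coordinate j = begin
      card
        ≡⟨ ∑-cong 𝓦.elems (λ v → ℚₚ.*-identityʳ ⟦ D? v ⟧) ⟨
      ∑ 𝓦.elems (λ v → ⟦ D? v ⟧ * 1ℚ)
        ≡⟨ ∑-coordinate j (λ _ → 1ℚ) (λ _ → refl) ⟩
      multiplicity j 0# * ∑ 𝓡.elems (λ x → ⟦ coordinate? j x ⟧ * 1ℚ)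
        ≡⟨ cong (multiplicity j 0# *_) (∑-cong 𝓡.elems (λ x → ℚₚ.*-identityʳ ⟦ coordinate? j x ⟧)) ⟩
      multiplicity j 0# * ∑ 𝓡.elems (λ x → ⟦ coordinate? j x ⟧)
        ∎

    Active : Pred (Fin n) 0ℓ
    Active j = ∃ λ v → D v × ¬ lookup v j ≈ 0#

    active? : Decidable Active
    active? j = 𝓦.search (λ v → D? v ×-dec ¬? (_≈?_ R (lookup v j) 0#))
      (λ u≈v (Dv , vⱼ≉0) → resp (≈-sym ∘ u≈v) Dv , λ uⱼ≈0 → vⱼ≉0 (≈-trans (≈-sym (u≈v j)) uⱼ≈0))

    -- The quantity m(D) of the overview.
    effectiveLength : ℚ
    effectiveLength = ∑ (allFin n) (λ j → ⟦ active? j ⟧)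

  -- Averages of a homogeneous weight over left ideals and linear codes.

  module Weight (frobenius : IsFrobenius R) {w : Carrier → ℚ} {γ : ℚ} (w-homogeneous : IsHomogeneousWeight R w γ) where

    open IsHomogeneousWeight w-homogeneous

    private
      χ : Carrier → ℕ
      χ = proj₁ frobenius

      χ-char : IsCharacter R χ
      χ-char = proj₁ (proj₂ frobenius)

      Ψ : Carrier → ℚ
      Ψ = ψ χ χ-char

      -- By the Frobenius property a nonzero left ideal is not contained in the kernel of `χ`, so
      -- `ψ-null` applies.
      Ψ-null : {I : Pred Carrier 0ℓ} (I? : Decidable I) → IsLeftIdeal R I → (∃ λ x → I x × ¬ x ≈ 0#) →
        ∑ 𝓡.elems (λ x → ⟦ I? x ⟧ * Ψ x) ≡ 0ℚ
      Ψ-null I? I-ideal (x , Ix , x≉0) = ψ-null χ χ-char I? I-ideal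
        λ I⊆ker → x≉0 (proj₁ (proj₂ (proj₂ frobenius)) _ I-ideal I⊆ker x Ix)

      -- The difference `γ ℚ.- w x` sums to zero over nonzero principal left ideals but equals `γ`
      -- at zero. The term `γ * Ψ x` corrects the value at zero, as `Ψ 0#` is 1, and adds nothing
      -- over nonzero left ideals.
      defect : Carrier → ℚ
      defect x = γ ℚ.- w x ℚ.- γ * Ψ x

      ∑-defect : {P : Pred Carrier 0ℓ} (P? : Decidable P) →
        ∑ 𝓡.elems (λ x → ⟦ P? x ⟧ * Ψ x) ≡ 0ℚ →
        ∑ 𝓡.elems (λ x → ⟦ P? x ⟧ * defect x) ≡
        γ * ∑ 𝓡.elems (λ x → ⟦ P? x ⟧) ℚ.- ∑ 𝓡.elems (λ x → ⟦ P? x ⟧ * w x)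
      ∑-defect P? Ψ-null = begin
        ∑ 𝓡.elems (λ x → ⟦ P? x ⟧ * defect x)
          ≡⟨ ∑-cong 𝓡.elems (λ x → solve 4 (λ p g v s → p :* (g :- v :- g :* s) :=
               g :* p :+ (con (ℚ.- 1ℚ) :* (p :* v) :+ (:- g) :* (p :* s))) refl ⟦ P? x ⟧ γ (w x) (Ψ x)) ⟩
        ∑ 𝓡.elems (λ x → γ * ⟦ P? x ⟧ + (ℚ.- 1ℚ * (⟦ P? x ⟧ * w x) + ℚ.- γ * (⟦ P? x ⟧ * Ψ x)))
          ≡⟨ trans (∑-+ 𝓡.elems _ _) (cong₂ _+_ (∑-*ˡ γ 𝓡.elems _) (trans (∑-+ 𝓡.elems _ _)
               (cong₂ _+_ (∑-*ˡ (ℚ.- 1ℚ) 𝓡.elems _) (trans (∑-*ˡ (ℚ.- γ) 𝓡.elems _) (cong (ℚ.- γ *_) Ψ-null))))) ⟩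
        γ * ∑ 𝓡.elems (λ x → ⟦ P? x ⟧) + (ℚ.- 1ℚ * ∑ 𝓡.elems (λ x → ⟦ P? x ⟧ * w x) + ℚ.- γ * 0ℚ)
          ≡⟨ solve 3 (λ g a b → g :* a :+ (con (ℚ.- 1ℚ) :* b :+ (:- g) :* con 0ℚ) := g :* a :- b) refl γ _ _ ⟩
        γ * ∑ 𝓡.elems (λ x → ⟦ P? x ⟧) ℚ.- ∑ 𝓡.elems (λ x → ⟦ P? x ⟧ * w x)
          ∎

    w-cong : ∀ {x y} → x ≈ y → w x ≡ w y
    w-cong x≈y = w-ideal _ _ ((λ _ → InRx-trans (InRx-reflexive (≈-sym x≈y))) , (λ _ → InRx-trans (InRx-reflexive x≈y)))

    private
      defect-principal : ∀ x → ∑ 𝓡.elems (λ y → ⟦ inRx? R x y ⟧ * defect y) ≡ 0ℚ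
      defect-principal x with _≈?_ R x 0#
      ... | yes x≈0 = ∑-zero 𝓡.elems λ y → trans
        (⟦⟧*-cong (inRx? R x y) (λ (r , rx≈y) → defect-0 (≈-trans (≈-sym rx≈y) (≈-trans (⊛-cong ≈-refl x≈0) (⊛-zeroʳ r)))))
        (ℚₚ.*-zeroʳ ⟦ inRx? R x y ⟧)
        where
        defect-0 : ∀ {y} → y ≈ 0# → defect y ≡ 0ℚ
        defect-0 {y} y≈0 = begin
          γ ℚ.- w y ℚ.- γ * Ψ y   ≡⟨ cong₂ (λ a b → γ ℚ.- a ℚ.- γ * b)
                                       (trans (w-cong y≈0) w-zero)
                                       (trans (ψ-cong χ χ-char y≈0) (ψ-0# χ χ-char)) ⟩
          γ ℚ.- 0ℚ ℚ.- γ * 1ℚ     ≡⟨ solve 1 (λ g → g :- con 0ℚ :- g :* con 1ℚ := con 0ℚ) refl γ ⟩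
          0ℚ                      ∎
      ... | no x≉0 = begin
        ∑ 𝓡.elems (λ y → ⟦ inRx? R x y ⟧ * defect y)
          ≡⟨ ∑-defect (inRx? R x) (Ψ-null (inRx? R x) (InRx-isLeftIdeal x) (x , InRx-refl x , x≉0)) ⟩
        γ * ∑ 𝓡.elems (λ y → ⟦ inRx? R x y ⟧) ℚ.- ∑ 𝓡.elems (λ y → ⟦ inRx? R x y ⟧ * w y)
          ≡⟨ cong₂ (λ a b → γ * a ℚ.- b) (toℚ-countR (inRx? R x)) (sumR≡∑ (inRx? R x) w) ⟨
        γ * toℚ (cardRx R x) ℚ.- sumR R (inRx? R x) w
          ≡⟨ cong (λ a → γ * toℚ (cardRx R x) ℚ.- a) (w-average x x≉0) ⟩
        γ * toℚ (cardRx R x) ℚ.- γ * toℚ (cardRx R x)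
          ≡⟨ ℚₚ.+-inverseʳ (γ * toℚ (cardRx R x)) ⟩
        0ℚ ∎

    -- The sum of `defect` over `I` vanishes by reduction to principal ideals, and the sum of `Ψ`
    -- vanishes because `I` is nonzero; what remains is the asserted equality.
    ideal-average : {I : Pred Carrier 0ℓ} (I? : Decidable I) → IsLeftIdeal R I → (∃ λ x → I x × ¬ x ≈ 0#) →
      ∑ 𝓡.elems (λ x → ⟦ I? x ⟧ * w x) ≡ γ * ∑ 𝓡.elems (λ x → ⟦ I? x ⟧)
    ideal-average I? I-ideal nonzero = begin
      ∑ 𝓡.elems (λ x → ⟦ I? x ⟧ * w x)
        ≡⟨ solve 2 (λ a b → b := a :- (a :- b)) refl (γ * ∑ 𝓡.elems (λ x → ⟦ I? x ⟧)) _ ⟩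
      total ℚ.- (total ℚ.- ∑ 𝓡.elems (λ x → ⟦ I? x ⟧ * w x))
        ≡⟨ cong (λ a → total ℚ.- a) (trans (sym (∑-defect I? (Ψ-null I? I-ideal nonzero)))
             (null-on-principal⇒null defect defect-principal I? I-ideal)) ⟩
      total ℚ.- 0ℚ
        ≡⟨ ℚₚ.+-identityʳ total ⟩
      total ∎
      where
      total : ℚ
      total = γ * ∑ 𝓡.elems (λ x → ⟦ I? x ⟧)

    -- Sum coordinate by coordinate. The projection to an active coordinate is a nonzero left ideal,
    -- so that coordinate contributes `γ * card`; an inactive one contributes 0.
    code-weight : ∀ {n} {D : Pred (Word R n) 0ℓ} (D? : Decidable D) (D-linear : IsLinearCode R n D) →
      let open LinearCode D? D-linear in
      ∑ (allWords R n) (λ v → ⟦ D? v ⟧ * wtᵛ R w v) ≡ γ * effectiveLength * card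
    code-weight {n} D? D-linear = begin
      ∑ 𝓦.elems (λ v → ⟦ D? v ⟧ * wtᵛ R w v)
        ≡⟨ ∑-cong 𝓦.elems (λ v → trans (cong (⟦ D? v ⟧ *_) (wtᵛ≡∑ w v)) (sym (∑-*ˡ ⟦ D? v ⟧ (allFin n) _))) ⟩
      ∑ 𝓦.elems (λ v → ∑ (allFin n) (λ j → ⟦ D? v ⟧ * w (lookup v j)))
        ≡⟨ ∑-comm 𝓦.elems (allFin n) _ ⟩
      ∑ (allFin n) (λ j → ∑ 𝓦.elems (λ v → ⟦ D? v ⟧ * w (lookup v j)))
        ≡⟨ ∑-cong (allFin n) (λ j → coordinate-weight j (active? j)) ⟩
      ∑ (allFin n) (λ j → γ * card * ⟦ active? j ⟧)
        ≡⟨ ∑-*ˡ (γ * card) (allFin n) _ ⟩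
      γ * card * effectiveLength
        ≡⟨ solve 3 (λ g c e → g :* c :* e := g :* e :* c) refl γ card effectiveLength ⟩
      γ * effectiveLength * card ∎
      where
      open LinearCode D? D-linear
      module 𝓦 = Enumeration (Word-enumeration n)

      coordinate-weight : ∀ j (d : Dec (Active j)) → ∑ 𝓦.elems (λ v → ⟦ D? v ⟧ * w (lookup v j)) ≡ γ * card * ⟦ d ⟧
      coordinate-weight j (yes (v , Dv , vⱼ≉0)) = begin
        ∑ 𝓦.elems (λ v → ⟦ D? v ⟧ * w (lookup v j))
          ≡⟨ ∑-coordinate j w w-cong ⟩
        multiplicity j 0# * ∑ 𝓡.elems (λ x → ⟦ coordinate? j x ⟧ * w x)
          ≡⟨ cong (multiplicity j 0# *_) (ideal-average (coordinate? j) (coordinate-isLeftIdeal j)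
               (lookup v j , (v , Dv , ≈-refl) , vⱼ≉0)) ⟩
        multiplicity j 0# * (γ * ∑ 𝓡.elems (λ x → ⟦ coordinate? j x ⟧))
          -- The trailing factor 1 is the indicator of the active coordinate.
          ≡⟨ solve 3 (λ m g s → m :* (g :* s) := g :* (m :* s) :* con 1ℚ) refl (multiplicity j 0#) γ _ ⟩
        γ * (multiplicity j 0# * ∑ 𝓡.elems (λ x → ⟦ coordinate? j x ⟧)) * 1ℚ
          ≡⟨ cong (λ c → γ * c * 1ℚ) (card-coordinate j) ⟨
        γ * card * 1ℚ ∎
      coordinate-weight j (no inactive) = trans (∑-zero 𝓦.elems vanish) (sym (ℚₚ.*-zeroʳ (γ * card)))
        where
        vanish : ∀ v → ⟦ D? v ⟧ * w (lookup v j) ≡ 0ℚ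
        vanish v with D? v
        ... | no  _  = ℚₚ.*-zeroˡ (w (lookup v j))
        ... | yes Dv with _≈?_ R (lookup v j) 0#
        ...   | yes vⱼ≈0 = cong (1ℚ *_) (trans (w-cong vⱼ≈0) w-zero)
        ...   | no  vⱼ≉0 = contradiction (v , Dv , vⱼ≉0) inactive

    -- Comparing a code with its subcodes.

    module _ {n : ℕ} {C : Pred (Word R n) 0ℓ} (C? : Decidable C) (C-linear : IsLinearCode R n C)
             {d : ℚ} (d-minimal : ∀ v → C v → ¬ _≈ᵛ_ R v (0ᵛ R) → d ℚ.≤ wtᵛ R w v) where

      private
        module 𝓦 = Enumeration (Word-enumeration n)
        module 𝓒 = LinearCode C? C-linear

      -- Words of `C` outside `D` are nonzero, since `D` contains the zero word, and hence weigh at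
      -- least `d`. Summing over `C` and evaluating both total weights by `code-weight` gives the
      -- inequality.
      subcode-bound : {D : Pred (Word R n) 0ℓ} (D? : Decidable D) (D-linear : IsLinearCode R n D) → (∀ {v} → D v → C v) →
        let module 𝓓 = LinearCode D? D-linear in
        𝓒.card * (d ℚ.- γ * 𝓒.effectiveLength) ℚ.≤ 𝓓.card * (d ℚ.- γ * 𝓓.effectiveLength)
      subcode-bound D? D-linear D⊆C = subst₂ ℚ._≤_
        (solve 4 (λ c d g e → d :* c :- g :* e :* c := c :* (d :- g :* e)) refl 𝓒.card d γ 𝓒.effectiveLength)
        (solve 5 (λ c d g e k → d :* c :- (g :* e :* k :+ d :* (c :+ con (ℚ.- 1ℚ) :* k)) := k :* (d :- g :* e))
          refl 𝓒.card d γ 𝓓.effectiveLength 𝓓.card)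
        (ℚₚ.+-monoʳ-≤ (d * 𝓒.card) (ℚₚ.neg-antimono-≤ weights))
        where
        module 𝓓 = LinearCode D? D-linear

        -- As `D` lies in `C`, the factor after `d` is the indicator of the complement of `D` in
        -- `C`, written linearly so that its sum splits into the two cardinalities.
        pointwise : ∀ v → ⟦ D? v ⟧ * wtᵛ R w v + d * (⟦ C? v ⟧ + ℚ.- 1ℚ * ⟦ D? v ⟧) ℚ.≤ ⟦ C? v ⟧ * wtᵛ R w v
        pointwise v with D? v | C? v
        ... | yes Dv | yes _  = ℚₚ.≤-reflexive
          (solve 2 (λ a d → con 1ℚ :* a :+ d :* (con 1ℚ :+ con (ℚ.- 1ℚ) :* con 1ℚ) := con 1ℚ :* a) refl (wtᵛ R w v) d)
        ... | yes Dv | no ¬Cv = contradiction (D⊆C Dv) ¬Cv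
        ... | no  _  | no  _  = ℚₚ.≤-reflexive
          (solve 2 (λ a d → con 0ℚ :* a :+ d :* (con 0ℚ :+ con (ℚ.- 1ℚ) :* con 0ℚ) := con 0ℚ :* a) refl (wtᵛ R w v) d)
        ... | no ¬Dv | yes Cv = subst₂ ℚ._≤_
          (solve 2 (λ a d → d := con 0ℚ :* a :+ d :* (con 1ℚ :+ con (ℚ.- 1ℚ) :* con 0ℚ)) refl (wtᵛ R w v) d)
          (sym (ℚₚ.*-identityˡ (wtᵛ R w v)))
          (d-minimal v Cv (λ v≈0 → ¬Dv (IsLinearCode.resp D-linear (≈-sym ∘ v≈0) (IsLinearCode.zero∈ D-linear))))

        weights : γ * 𝓓.effectiveLength * 𝓓.card + d * (𝓒.card + ℚ.- 1ℚ * 𝓓.card) ℚ.≤ γ * 𝓒.effectiveLength * 𝓒.card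
        weights = subst₂ ℚ._≤_
          (trans (∑-+ 𝓦.elems _ _) (cong₂ _+_ (code-weight D? D-linear)
            (trans (∑-*ˡ d 𝓦.elems _) (cong (d *_) (trans (∑-+ 𝓦.elems _ _) (cong (𝓒.card +_) (∑-*ˡ (ℚ.- 1ℚ) 𝓦.elems _)))))))
          (code-weight C? C-linear)
          (∑-mono 𝓦.elems pointwise)

      cyclic-bound : ∀ c → C c →
        𝓒.card * (d ℚ.- γ * 𝓒.effectiveLength) ℚ.≤ toℚ (cardRc R c) * (d ℚ.- γ * toℚ (hamming R c))
      cyclic-bound c Cc = subst₂ (λ k e → 𝓒.card * (d ℚ.- γ * 𝓒.effectiveLength) ℚ.≤ k * (d ℚ.- γ * e))
        (sym (toℚ-length-filter (inRc? R c) (allWords R n))) effectiveLength≡hamming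
        (subcode-bound (inRc? R c) (InRc-isLinearCode c)
          (λ (r , rc≈v) → IsLinearCode.resp C-linear rc≈v (IsLinearCode.·-closed C-linear r Cc)))
        where
        module 𝓡𝓬 = LinearCode (inRc? R c) (InRc-isLinearCode c)

        active⇒≉0 : ∀ {j} → 𝓡𝓬.Active j → ¬ lookup c j ≈ 0#
        active⇒≉0 {j} (v , (r , rc≈v) , vⱼ≉0) cⱼ≈0 = vⱼ≉0
          (≈-trans (≈-sym (rc≈v j)) (≈-trans (lookup-·ᵛ r c j) (≈-trans (⊛-cong ≈-refl cⱼ≈0) (⊛-zeroʳ r))))

        -- A multiple of `c` vanishes wherever `c` does, and `c` itself belongs to Rc.
        effectiveLength≡hamming : 𝓡𝓬.effectiveLength ≡ toℚ (hamming R c)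
        effectiveLength≡hamming = trans
          (∑-cong (allFin n) (λ j → ⟦⟧-cong (𝓡𝓬.active? j) (¬? (_≈?_ R (lookup c j) 0#)) active⇒≉0
            (λ cⱼ≉0 → c , (1# , λ i → ≈-trans (lookup-·ᵛ 1# c i) (⊛-identityˡ _)) , cⱼ≉0)))
          (sym (toℚ-length-filter (λ j → ¬? (_≈?_ R (lookup c j) 0#)) (allFin n)))

      effectiveLength≤n : 𝓒.effectiveLength ℚ.≤ toℚ n
      effectiveLength≤n = subst (𝓒.effectiveLength ℚ.≤_) (∑-1 n)
        (∑-mono (allFin n) (λ j → ⟦⟧-mono (𝓒.active? j) (yes tt) (λ _ → tt)))
        where
        ∑-1 : ∀ m → ∑ (allFin m) (λ _ → 1ℚ) ≡ toℚ m
        ∑-1 zero    = ∑-[]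
        ∑-1 (suc m) = trans (∑-allFin-suc m (λ _ → 1ℚ)) (trans (cong (1ℚ +_) (∑-1 m)) (sym (toℚ-suc m)))

      hamming≤effectiveLength : ∀ c → C c → toℚ (hamming R c) ℚ.≤ 𝓒.effectiveLength
      hamming≤effectiveLength c Cc = subst (ℚ._≤ 𝓒.effectiveLength)
        (sym (toℚ-length-filter (λ j → ¬? (_≈?_ R (lookup c j) 0#)) (allFin n)))
        (∑-mono (allFin n) (λ j → ⟦⟧-mono (¬? (_≈?_ R (lookup c j) 0#)) (𝓒.active? j) (λ cⱼ≉0 → c , Cc , cⱼ≉0)))

      1≤effectiveLength : IsNonzeroCode R n C → 1ℚ ℚ.≤ 𝓒.effectiveLength
      1≤effectiveLength (c , Cc , c≉0) = at (Finₚ.¬∀⟶∃¬ n _ (λ j → _≈?_ R (lookup c j) (lookup (0ᵛ R) j)) c≉0)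
        where
        at : (∃ λ j → ¬ lookup c j ≈ lookup (0ᵛ R) j) → 1ℚ ℚ.≤ 𝓒.effectiveLength
        at (j , cⱼ≉0) = subst (ℚ._≤ 𝓒.effectiveLength) (Enumeration.once (Fin-enumeration n) j)
          (∑-mono (allFin n) (λ i → ⟦⟧-mono (i Fin.≟ j) (𝓒.active? i)
            (λ { refl → c , Cc , λ cⱼ≈0 → cⱼ≉0 (≈-trans cⱼ≈0 (≈-sym (lookup-0ᵛ j))) })))

      -- For γ < 0 the hypothesis γ ℓ(c) < d gives d - γ m > 0 for the effective length m ≥ ℓ(c); comparing C with the
      -- zero code then yields d - γ m ≤ |C| (d - γ m) ≤ d, contradicting γ m < 0.
      0≤γ : IsNonzeroCode R n C → ∀ c → C c → γ * toℚ (hamming R c) ℚ.< d → 0ℚ ℚ.≤ γ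
      0≤γ C-nonzero c Cc γℓ<d with 0ℚ ℚₚ.≤? γ
      ... | yes 0≤γ = 0≤γ
      ... | no  0≰γ = contradiction
        (ℚₚ.≤-<-trans (ℚₚ.≤-trans (ℚₚ.≤-trans ρ≤cardρ cardρ≤d) (ℚₚ.≤-reflexive d≡ρ+γm))
          (subst (ρ + γ * 𝓒.effectiveLength ℚ.<_) (ℚₚ.+-identityʳ ρ) (ℚₚ.+-monoʳ-< ρ γm<0)))
        (ℚₚ.<-irrefl refl)
        where
        γ<0 : γ ℚ.< 0ℚ
        γ<0 = ℚₚ.≰⇒> 0≰γ

        ρ : ℚ
        ρ = d ℚ.- γ * 𝓒.effectiveLength

        γ-antitone : ∀ {p q} → p ℚ.≤ q → γ * q ℚ.≤ γ * p
        γ-antitone = ℚₚ.*-monoˡ-≤-nonPos γ {{ℚ.nonPositive (ℚₚ.<⇒≤ γ<0)}}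

        -- A nonzero code has effective length at least 1, so multiplying it by the negative `γ`
        -- gives at most `γ`.
        γm<0 : γ * 𝓒.effectiveLength ℚ.< 0ℚ
        γm<0 = ℚₚ.≤-<-trans (γ-antitone (1≤effectiveLength C-nonzero)) (subst (ℚ._< 0ℚ) (sym (ℚₚ.*-identityʳ γ)) γ<0)

        0<ρ : 0ℚ ℚ.< ρ
        0<ρ = <⇒0<- (ℚₚ.≤-<-trans (γ-antitone (hamming≤effectiveLength c Cc)) γℓ<d)

        d≡ρ+γm : d ≡ ρ + γ * 𝓒.effectiveLength
        d≡ρ+γm = solve 2 (λ d a → d := d :- a :+ a) refl d (γ * 𝓒.effectiveLength)

        zero? : Decidable (λ v → _≈ᵛ_ R v (0ᵛ R))
        zero? v = _≈ᵛ?_ R v (0ᵛ R)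

        zero⇒C : ∀ {v} → _≈ᵛ_ R v (0ᵛ R) → C v
        zero⇒C v≈0 = IsLinearCode.resp C-linear (≈-sym ∘ v≈0) (IsLinearCode.zero∈ C-linear)

        ρ≤cardρ : ρ ℚ.≤ 𝓒.card * ρ
        ρ≤cardρ = subst (ℚ._≤ 𝓒.card * ρ) (ℚₚ.*-identityˡ ρ) (ℚₚ.*-monoʳ-≤-nonNeg ρ {{ℚ.nonNegative (ℚₚ.<⇒≤ 0<ρ)}}
          -- `C` has at least one word, the zero word, which `once` counts exactly once.
          (subst (ℚ._≤ 𝓒.card) (𝓦.once (0ᵛ R)) (∑-mono 𝓦.elems (λ v → ⟦⟧-mono (zero? v) (C? v) zero⇒C))))

        -- The zero code has one word and effective length 0, so its side of `subcode-bound` is just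
        -- `d`.
        cardρ≤d : 𝓒.card * ρ ℚ.≤ d
        cardρ≤d = subst (𝓒.card * ρ ℚ.≤_)
          (trans (cong₂ (λ k e → k * (d ℚ.- γ * e)) (𝓦.once (0ᵛ R))
            (∑-zero (allFin n) (λ j → ⟦⟧-false (LinearCode.active? zero? zeroCode-isLinear j)
              (λ (v , v≈0 , vⱼ≉0) → vⱼ≉0 (≈-trans (v≈0 j) (lookup-0ᵛ j))))))
            (solve 2 (λ d g → con 1ℚ :* (d :- g :* con 0ℚ) := d) refl d γ))
          (subcode-bound zero? zeroCode-isLinear zero⇒C)

      -- With `γ` nonnegative, replacing the effective length by the larger `n` only decreases the
      -- left side of `cyclic-bound`.
      card-bound : IsNonzeroCode R n C → ∀ c → C c → γ * toℚ (hamming R c) ℚ.< d →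
        toℚ (countW R C?) * (d ℚ.- γ * toℚ n) ℚ.≤ toℚ (cardRc R c) * (d ℚ.- γ * toℚ (hamming R c))
      card-bound C-nonzero c Cc γℓ<d = ℚₚ.≤-trans
        (ℚₚ.*-monoˡ-≤-nonNeg (toℚ (countW R C?)) {{ℚₚ.normalize-nonNeg (countW R C?) 1}}
          (ℚₚ.+-monoʳ-≤ d (ℚₚ.neg-antimono-≤
            (ℚₚ.*-monoˡ-≤-nonNeg γ {{ℚ.nonNegative (0≤γ C-nonzero c Cc γℓ<d)}} effectiveLength≤n))))
        (subst (λ k → k * (d ℚ.- γ * 𝓒.effectiveLength) ℚ.≤ _) (sym (toℚ-length-filter C? (allWords R n)))
          (cyclic-bound c Cc))

-- From the product inequality to the quotient.

≤-boundQuot : ∀ {x} k a {p q} (p<q : p ℚ.< q) → x * (q ℚ.- p) ℚ.≤ toℚ k * a → x ℚ.≤ boundQuot k a p q p<q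
≤-boundQuot {x} k a {p} {q} p<q x[q-p]≤ka =
  ℚₚ.*-cancelʳ-≤-pos (q ℚ.- p) (subst (x * (q ℚ.- p) ℚ.≤_) (sym cancel) x[q-p]≤ka)
  where
  instance
    q-p>0 : ℚ.Positive (q ℚ.- p)
    q-p>0 = ℚ.positive (<⇒0<- p<q)

    q-p≢0 : ℚ.NonZero (q ℚ.- p)
    q-p≢0 = ℚₚ.pos⇒nonZero (q ℚ.- p)

  cancel : boundQuot k a p q p<q * (q ℚ.- p) ≡ toℚ k * a
  cancel = begin
    toℚ k * a * ℚ.1/ (q ℚ.- p) * (q ℚ.- p)    ≡⟨ ℚₚ.*-assoc (toℚ k * a) (ℚ.1/ (q ℚ.- p)) (q ℚ.- p) ⟩
    toℚ k * a * (ℚ.1/ (q ℚ.- p) * (q ℚ.- p))  ≡⟨ cong (toℚ k * a *_) (ℚₚ.*-inverseˡ (q ℚ.- p)) ⟩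
    toℚ k * a * 1ℚ                            ≡⟨ ℚₚ.*-identityʳ (toℚ k * a) ⟩
    toℚ k * a                                 ∎

theorem1 : (R : FiniteRing) → IsFrobenius R →
    (w : FiniteRing.Carrier R → ℚ) (γ : ℚ) → IsHomogeneousWeight R w γ →
    (n : ℕ) (C : Pred (Word R n) 0ℓ) (C? : Decidable C) →
    IsLinearCode R n C → IsNonzeroCode R n C →
    (d : ℚ) → IsMinWeight R w n C d →
    (hn : γ ℚ.* toℚ n ℚ.< d) →
    (c : Word R n) → C c → (hc : γ ℚ.* toℚ (hamming R c) ℚ.< d) →
    toℚ (countW R C?) ℚ.≤ boundQuot (cardRc R c) (d ℚ.- γ ℚ.* toℚ (hamming R c)) (γ ℚ.* toℚ n) d hn
theorem1 R frobenius w γ w-homogeneous n C C? C-linear C-nonzero d (_ , d-minimal) hn c Cc hc =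
  ≤-boundQuot (cardRc R c) (d ℚ.- γ * toℚ (hamming R c)) hn
    (Weight.card-bound R frobenius w-homogeneous C? C-linear d-minimal C-nonzero c Cc hc)
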